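{- Let $\ell\ge 2$. Suppose that $\lambda$ is an $\ell$-partition and $0\le i<\ell$. Write $\varphi=\varphi_i(\lambda)$ and $\varepsilon=\varepsilon_i(\lambda)$. Then 1. $\widetilde f_i^{\,\varphi}\lambda$ is an $\ell$-partition; 2. $\widetilde e_i^{\,\varepsilon}\lambda$ is an $\ell$-partition.
   Context: A partition is $\ell$-regular if it does not have $\ell$ or more equal nonzero parts. A removable $\ell$-rim hook (for short, $\ell$-rim hook) of $\lambda$ is a connected sequence of $\ell$ boxes of the Young diagram of $\lambda$, containing no $2\times2$ square, whose removal from $\lambda$ leaves the Young diagram of a partition. It is horizontal if all its boxes lie in one row, and non-horizontal otherwise. An $\ell$-partition is an $\ell$-regular partition which has no non-horizontal $\ell$-rim hooks and such that, after removing any number of horizontal $\ell$-rim hooks in any order, the remaining diagram has no non-horizontal $\ell$-rim hooks. Crystal $B(\Lambda_0)$ of $\widehat{\mathfrak{sl}_\ell}$ (nodes: the $\ell$-regular partitions). The position in row $a$, column $b$ has residue $b-a \bmod \ell$. A box $x$ of $\lambda$ is a removable $i$-box if it has residue $i$ and $\lambda\setminus x$ is a partition; a position $y\notin\lambda$ is an addable $i$-box if it has residue $i$ and $\lambda\cup y$ is a partition. Put $-$ in each removable $i$-box and $+$ in each addable $i$-box. The $i$-signature of $\lambda$ is the word of $+$'s and $-$'s read from bottom left to top right; the reduced $i$-signature is obtained by repeatedly deleting adjacent pairs $-+$, giving a word $+\cdots+-\cdots-$. Boxes of the remaining $-$'s are the normal $i$-boxes and boxes of the remaining $+$'s are the conormal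 $i$-boxes; $\varepsilon_i(\lambda)$ and $\varphi_i(\lambda)$ are their respective numbers. The good $i$-box is the one of the leftmost remaining $-$; the cogood $i$-box is the one of the rightmost remaining $+$. $\widetilde e_i\lambda$ is $\lambda$ with its good $i$-box removed (or $0$ if there is none), and $\widetilde f_i\lambda$ is $\lambda$ with its cogood $i$-box added (or $0$ if there is none). -}

module Defs where

open import Data.Empty using (⊥-elim)
open import Data.Integer as ℤ using ()
open import Data.Integer.DivMod using (_%ℕ_)
open import Data.List using (List; []; _∷_; [_]; length; filter; mapMaybe; cartesianProduct; upTo; downFrom; head; last)
open import Data.List.Membership.Propositional using (_∈_; _∉_)
open import Data.List.Relation.Unary.All using (All; []; _∷_)
open import Data.List.Relation.Unary.Any as Any using ()
open import Data.List.Relation.Unary.Linked using (Linked; []; [-]; _∷_)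
open import Data.List.Relation.Unary.Unique.Propositional using (Unique)
open import Data.Maybe as Maybe using (Maybe; just; nothing; _>>=_)
open import Data.Nat using (ℕ; zero; suc; _≤_; _<_; _≥_; z≤n; s≤s; NonZero; _≟_; _<?_; _≤?_)
open import Data.Nat.Properties using (≤-refl; ≤-trans; ≤-reflexive; <-irrefl; ≮⇒≥; n≤1+n; <⇒≤; suc-injective; m≤n⇒m<n∨m≡n)
open import Data.Product using (Σ; ∃; _×_; _,_; proj₁; proj₂)
open import Data.Sum using (_⊎_; inj₁; inj₂)
open import Function using (_∘_)
open import Function.Bundles using (_⇔_; mk⇔; Equivalence)
open import Relation.Binary.Construct.Closure.ReflexiveTransitive using (Star; ε; _◅_; _◅◅_; gmap)
open import Relation.Binary.PropositionalEquality using (_≡_; _≢_; refl; sym; cong; subst)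
open import Relation.Nullary using (Dec; yes; no; ¬_)
open import Relation.Nullary.Decidable using (map′; _×-dec_)

-- Boxes are (row , column), both counted from 0, with row 0 at the top
-- (English notation).  The residue, depending only on column - row, is the
-- same as with counting from 1.
Box : Set
Box = ℕ × ℕ

row : Box → ℕ
row = proj₁

record Partition : Set where
  field
    parts      : List ℕ
    positive   : All (0 <_) parts
    decreasing : Linked _≥_ parts

open Partition public

-- The a-th entry, with the convention that a list is continued by zeros.
entry : List ℕ → ℕ → ℕ
entry []       _       = 0
entry (x ∷ _)  zero    = x
entry (_ ∷ xs) (suc a) = entry xs a

part : Partition → ℕ → ℕ
part p = entry (parts p)

infix 4 _∈ᵈ_ _∉ᵈ_ _≐_∖_ _≐_∪_

_∈ᵈ_ : Box → Partition → Set
(a , b) ∈ᵈ p = b < part p a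

_∉ᵈ_ : Box → Partition → Set
x ∉ᵈ p = ¬ (x ∈ᵈ p)

-- Equalities of sets of boxes: the diagram of q is that of p with the boxes xs
-- taken away, respectively with the box y put in.
_≐_∖_ : Partition → Partition → List Box → Set
q ≐ p ∖ xs = ∀ z → z ∈ᵈ q ⇔ (z ∈ᵈ p × z ∉ xs)

_≐_∪_ : Partition → Partition → Box → Set
q ≐ p ∪ y = ∀ z → z ∈ᵈ q ⇔ (z ∈ᵈ p ⊎ z ≡ y)

Regular : ℕ → Partition → Set
Regular ℓ p = ∀ k → 0 < k → ¬ (ℓ ≤ length (filter (_≟ k) (parts p)))

data Adjacent : Box → Box → Set where
  right : ∀ {a b} → Adjacent (a , b) (a , suc b)
  left  : ∀ {a b} → Adjacent (a , suc b) (a , b)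
  down  : ∀ {a b} → Adjacent (a , b) (suc a , b)
  up    : ∀ {a b} → Adjacent (suc a , b) (a , b)

ContainsSquare : List Box → Set
ContainsSquare xs = ∃ λ a → ∃ λ b →
  (a , b) ∈ xs × (a , suc b) ∈ xs × (suc a , b) ∈ xs × (suc a , suc b) ∈ xs

record RimHook (ℓ : ℕ) (p : Partition) : Set where
  field
    boxes     : List Box
    size      : length boxes ≡ ℓ
    distinct  : Unique boxes
    inside    : All (_∈ᵈ p) boxes
    connected : Linked Adjacent boxes
    noSquare  : ¬ ContainsSquare boxes
    remainder : Partition
    removes   : remainder ≐ p ∖ boxes

Horizontal : ∀ {ℓ p} → RimHook ℓ p → Set
Horizontal h = ∃ λ a → All (λ x → row x ≡ a) (RimHook.boxes h)

HasNonHorizontal : ℕ → Partition → Set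
HasNonHorizontal ℓ p = Σ (RimHook ℓ p) λ h → ¬ Horizontal h

RemoveHorizontal : ℕ → Partition → Partition → Set
RemoveHorizontal ℓ p q = Σ (RimHook ℓ p) λ h → Horizontal h × RimHook.remainder h ≡ q

-- The reflexive-transitive closure also covers removing no hook at all.
record IsℓPartition (ℓ : ℕ) (p : Partition) : Set where
  field
    regular         : Regular ℓ p
    noNonHorizontal : ∀ {q} → Star (RemoveHorizontal ℓ) p q → ¬ HasNonHorizontal ℓ q

Removable : Partition → Box → Set
Removable p x = x ∈ᵈ p × ∃ λ q → q ≐ p ∖ [ x ]

Addable : Partition → Box → Set
Addable p y = y ∉ᵈ p × ∃ λ q → q ≐ p ∪ y

-- Decidability of Removable and Addable, by comparing with the corners.

linked⇒entry : ∀ xs → Linked _≥_ xs → ∀ a → entry xs (suc a) ≤ entry xs a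
linked⇒entry []           _       _       = z≤n
linked⇒entry (_ ∷ [])     _       _       = z≤n
linked⇒entry (_ ∷ _ ∷ _)  (h ∷ _) zero    = h
linked⇒entry (_ ∷ y ∷ ys) (_ ∷ t) (suc a) = linked⇒entry (y ∷ ys) t a

entry⇒linked : ∀ xs → (∀ a → entry xs (suc a) ≤ entry xs a) → Linked _≥_ xs
entry⇒linked []           _ = []
entry⇒linked (_ ∷ [])     _ = [-]
entry⇒linked (_ ∷ y ∷ ys) h = h 0 ∷ entry⇒linked (y ∷ ys) (h ∘ suc)

part-mono : ∀ p a → part p (suc a) ≤ part p a
part-mono p = linked⇒entry (parts p) (decreasing p)

incr : ℕ → List ℕ → List ℕ
incr zero    []       = 1 ∷ []
incr (suc _) []       = []
incr zero    (x ∷ xs) = suc x ∷ xs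
incr (suc a) (x ∷ xs) = x ∷ incr a xs

incr-pos : ∀ a xs → All (0 <_) xs → All (0 <_) (incr a xs)
incr-pos zero    []       _        = s≤s z≤n ∷ []
incr-pos (suc _) []       _        = []
incr-pos zero    (_ ∷ _)  (_ ∷ hs) = s≤s z≤n ∷ hs
incr-pos (suc a) (_ ∷ xs) (h ∷ hs) = h ∷ incr-pos a xs hs

incr-same : ∀ a xs → (∀ c → a ≡ suc c → 0 < entry xs c) → entry (incr a xs) a ≡ suc (entry xs a)
incr-same zero          []       _ = refl
incr-same (suc a)       []       h with () ← h a refl
incr-same zero          (_ ∷ _)  _ = refl
incr-same (suc zero)    (_ ∷ xs) _ = incr-same zero xs λ _ ()
incr-same (suc (suc a)) (_ ∷ xs) h = incr-same (suc a) xs λ { c refl → h (suc c) refl }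

incr-other : ∀ a xs c → c ≢ a → entry (incr a xs) c ≡ entry xs c
incr-other zero    []       zero    n = ⊥-elim (n refl)
incr-other zero    []       (suc _) _ = refl
incr-other (suc _) []       _       _ = refl
incr-other zero    (_ ∷ _)  zero    n = ⊥-elim (n refl)
incr-other zero    (_ ∷ _)  (suc _) _ = refl
incr-other (suc _) (_ ∷ _)  zero    _ = refl
incr-other (suc a) (_ ∷ xs) (suc c) n = incr-other a xs c (n ∘ cong suc)

decr : ℕ → List ℕ → List ℕ
decr _       []                 = []
decr zero    (suc (suc x) ∷ xs) = suc x ∷ xs
decr zero    (_ ∷ _)            = []
decr (suc a) (x ∷ xs)           = x ∷ decr a xs

decr-pos : ∀ a xs → All (0 <_) xs → All (0 <_) (decr a xs)
decr-pos _       []                _        = []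
decr-pos zero    (zero ∷ _)        _        = []
decr-pos zero    (suc zero ∷ _)    _        = []
decr-pos zero    (suc (suc _) ∷ _) (_ ∷ hs) = s≤s z≤n ∷ hs
decr-pos (suc a) (_ ∷ xs)          (h ∷ hs) = h ∷ decr-pos a xs hs

decr-same : ∀ a xs b → entry xs a ≡ suc b → entry (decr a xs) a ≡ b
decr-same zero    (suc zero ∷ _)    _ refl = refl
decr-same zero    (suc (suc _) ∷ _) _ refl = refl
decr-same (suc a) (_ ∷ xs)          b e    = decr-same a xs b e

-- The hypotheses make a the last row whenever decr deletes that row.
decr-other : ∀ a xs b → All (0 <_) xs → entry xs a ≡ suc b → entry xs (suc a) ≤ b →
             ∀ c → c ≢ a → entry (decr a xs) c ≡ entry xs c
decr-other zero    _                     _ _ _    _ zero    n = ⊥-elim (n refl)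
decr-other zero    (suc zero ∷ [])       _ _ refl _ (suc _) _ = refl
decr-other zero    (suc zero ∷ _ ∷ _) _ (_ ∷ s≤s z≤n ∷ _) refl () (suc _) _
decr-other zero    (suc (suc _) ∷ _)     _ _ _    _ (suc _) _ = refl
decr-other (suc _) (_ ∷ _)               _ _ _    _ zero    _ = refl
decr-other (suc a) (_ ∷ xs) b (_ ∷ hs) e l (suc c) n = decr-other a xs b hs e l c (n ∘ cong suc)

module _ {xs ys : List ℕ} (a : ℕ) (other : ∀ c → c ≢ a → entry ys c ≡ entry xs c)
         (dec : ∀ c → entry xs (suc c) ≤ entry xs c)
         (above : ∀ c → a ≡ suc c → entry ys a ≤ entry xs c)
         (below : entry xs (suc a) ≤ entry ys a) where

  changed-dec : ∀ c → entry ys (suc c) ≤ entry ys c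
  changed-dec c with c ≟ a | suc c ≟ a
  ... | yes refl | _        = ≤-trans (≤-reflexive (other (suc c) λ ())) below
  ... | no _     | yes refl = ≤-trans (above c refl) (≤-reflexive (sym (other c λ ())))
  ... | no n     | no m     = ≤-trans (≤-reflexive (other (suc c) m))
                                (≤-trans (dec c) (≤-reflexive (sym (other c n))))

AddableCorner : Partition → Box → Set
AddableCorner p (a , b) = part p a ≡ b × (∀ c → a ≡ suc c → b < part p c)

RemovableCorner : Partition → Box → Set
RemovableCorner p (a , b) = part p a ≡ suc b × part p (suc a) ≤ b

addable⇒corner : ∀ p y → Addable p y → AddableCorner p y
addable⇒corner p (a , b) (y∉p , q , q≐) = part≡ , above
  where
  open module E z = Equivalence (q≐ z) using (to; from)
  y∈q : b < part q a
  y∈q = from (a , b) (inj₂ refl)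
  part≡ : part p a ≡ b
  part≡ with m≤n⇒m<n∨m≡n (≮⇒≥ y∉p)
  ... | inj₂ e = e
  ... | inj₁ l with to (a , part p a) (≤-trans (s≤s (<⇒≤ l)) y∈q)
  ...   | inj₁ k = ⊥-elim (<-irrefl refl k)
  ...   | inj₂ e = cong proj₂ e
  above : ∀ c → a ≡ suc c → b < part p c
  above c refl with to (c , b) (≤-trans y∈q (part-mono q c))
  ... | inj₁ k = k
  ... | inj₂ ()

corner⇒addable : ∀ p y → AddableCorner p y → Addable p y
corner⇒addable p (a , b) (refl , above) = <-irrefl refl , q , λ z → mk⇔ (to z) (from z)
  where
  ys = incr a (parts p)
  same : entry ys a ≡ suc (part p a)
  same = incr-same a (parts p) λ c e → ≤-trans (s≤s z≤n) (above c e)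
  other = incr-other a (parts p)
  q : Partition
  q = record
    { parts      = ys
    ; positive   = incr-pos a (parts p) (positive p)
    ; decreasing = entry⇒linked ys (changed-dec {parts p} {ys} a other (part-mono p)
        (λ c e → ≤-trans (≤-reflexive same) (above c e))
        (≤-trans (part-mono p a) (≤-trans (n≤1+n _) (≤-reflexive (sym same)))))
    }
  to : ∀ z → z ∈ᵈ q → z ∈ᵈ p ⊎ z ≡ (a , part p a)
  to (c , d) h with c ≟ a
  ... | no n     = inj₁ (subst (d <_) (other c n) h)
  ... | yes refl with m≤n⇒m<n∨m≡n (subst (d <_) same h)
  ...   | inj₁ (s≤s l) = inj₁ l
  ...   | inj₂ e       = inj₂ (cong (c ,_) (suc-injective e))
  from : ∀ z → z ∈ᵈ p ⊎ z ≡ (a , part p a) → z ∈ᵈ q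
  from _       (inj₂ refl) = subst (part p a <_) (sym same) ≤-refl
  from (c , d) (inj₁ h) with c ≟ a
  ... | no n     = subst (d <_) (sym (other c n)) h
  ... | yes refl = subst (d <_) (sym same) (≤-trans h (n≤1+n _))

removable⇒corner : ∀ p x → Removable p x → RemovableCorner p x
removable⇒corner p (a , b) (x∈p , q , q≐) = part≡ , ≮⇒≥ below
  where
  open module E z = Equivalence (q≐ z) using (to; from)
  x∉q : ¬ (b < part q a)
  x∉q h = proj₂ (to (a , b) h) (Any.here refl)
  part≡ : part p a ≡ suc b
  part≡ with m≤n⇒m<n∨m≡n x∈p
  ... | inj₂ e = sym e
  ... | inj₁ l = ⊥-elim (x∉q (≤-trans (n≤1+n _) (from (a , suc b) (l , λ { (Any.here ()) }))))
  below : ¬ (b < part p (suc a))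
  below h = x∉q (≤-trans (from (suc a , b) (h , λ { (Any.here ()) })) (part-mono q a))

corner⇒removable : ∀ p x → RemovableCorner p x → Removable p x
corner⇒removable p (a , b) (e , below) =
  ≤-reflexive (sym e) , q , λ z → mk⇔ (to z) (from z)
  where
  ys = decr a (parts p)
  same : entry ys a ≡ b
  same = decr-same a (parts p) b e
  other = decr-other a (parts p) b (positive p) e below
  q : Partition
  q = record
    { parts      = ys
    ; positive   = decr-pos a (parts p) (positive p)
    ; decreasing = entry⇒linked ys (changed-dec {parts p} {ys} a other (part-mono p)
        (λ { c refl → ≤-trans (≤-reflexive same) (≤-trans (n≤1+n b)
                        (≤-trans (≤-reflexive (sym e)) (part-mono p c))) })
        (≤-trans below (≤-reflexive (sym same))))
    }
  to : ∀ z → z ∈ᵈ q → z ∈ᵈ p × z ∉ [ (a , b) ]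
  to (c , d) h with c ≟ a
  ... | no n     = subst (d <_) (other c n) h , λ { (Any.here refl) → n refl }
  ... | yes refl = subst (d <_) (sym e) (≤-trans d<b (n≤1+n b)) , λ { (Any.here refl) → <-irrefl refl d<b }
    where
    d<b : d < b
    d<b = subst (d <_) same h
  from : ∀ z → z ∈ᵈ p × z ∉ [ (a , b) ] → z ∈ᵈ q
  from (c , d) (h , n) with c ≟ a
  ... | no m     = subst (d <_) (sym (other c m)) h
  ... | yes refl with m≤n⇒m<n∨m≡n (subst (d <_) e h)
  ...   | inj₁ (s≤s l) = subst (d <_) (sym same) l
  ...   | inj₂ k       = ⊥-elim (n (Any.here (cong (c ,_) (suc-injective k))))

above? : ∀ p a b → Dec (∀ c → a ≡ suc c → b < part p c)
above? p zero    b = yes λ _ ()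
above? p (suc c) b = map′ (λ { l _ refl → l }) (λ h → h c refl) (b <? part p c)

addable? : ∀ p y → Dec (Addable p y)
addable? p y@(a , b) = map′ (corner⇒addable p y) (addable⇒corner p y)
  ((part p a ≟ b) ×-dec above? p a b)

removable? : ∀ p x → Dec (Removable p x)
removable? p x@(a , b) = map′ (corner⇒removable p x) (removable⇒corner p x)
  ((part p a ≟ suc b) ×-dec (part p (suc a) ≤? b))

-- A sign of the signature remembers its box and why the box may be
-- removed or added.
data Signed (p : Partition) : Set where
  minus : (x : Box) → Removable p x → Signed p
  plus  : (y : Box) → Addable p y → Signed p

-- Deletion of one adjacent pair - +.
data Delete {p : Partition} : List (Signed p) → List (Signed p) → Set where
  here  : ∀ {x r y s w} → Delete (minus x r ∷ plus y s ∷ w) w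
  there : ∀ {s v w} → Delete v w → Delete (s ∷ v) (s ∷ w)

cancel : ∀ {p} → Signed p → List (Signed p) → List (Signed p)
cancel (minus _ _) (plus _ _ ∷ w) = w
cancel s           w              = s ∷ w

reduce : ∀ {p} → List (Signed p) → List (Signed p)
reduce []      = []
reduce (s ∷ w) = cancel s (reduce w)

-- The next two lemmas confirm that reduce w is the result of deleting
-- adjacent pairs - + from w until none is left.

private
  cancel-deletes : ∀ {p} (s : Signed p) w → Star Delete (s ∷ w) (cancel s w)
  cancel-deletes (plus _ _)  _               = ε
  cancel-deletes (minus _ _) []              = ε
  cancel-deletes (minus _ _) (minus _ _ ∷ _) = ε
  cancel-deletes (minus _ _) (plus _ _ ∷ _)  = here ◅ ε

  cancel-normal : ∀ {p} (s : Signed p) w →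
                  (∀ {v} → ¬ Delete w v) → ∀ {v} → ¬ Delete (cancel s w) v
  cancel-normal (plus _ _)  _               n (there d) = n d
  cancel-normal (minus _ _) []              n (there d) = n d
  cancel-normal (minus _ _) (minus _ _ ∷ _) n (there d) = n d
  cancel-normal (minus _ _) (plus _ _ ∷ _)  n d         = n (there d)

reduce-deletes : ∀ {p} (w : List (Signed p)) → Star Delete w (reduce w)
reduce-deletes []      = ε
reduce-deletes (s ∷ w) = gmap (s ∷_) there (reduce-deletes w) ◅◅ cancel-deletes s (reduce w)

reduce-normal : ∀ {p} (w : List (Signed p)) → ∀ {v} → ¬ Delete (reduce w) v
reduce-normal []      ()
reduce-normal (s ∷ w) = cancel-normal s (reduce w) (reduce-normal w)

-- A word containing no adjacent pair - + has the form + ... + - ... -, so in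
-- a reduced word these are its two halves, in order.
conormal : ∀ {p} → List (Signed p) → List (∃ (Addable p))
conormal []              = []
conormal (plus y s ∷ w)  = (y , s) ∷ conormal w
conormal (minus _ _ ∷ w) = conormal w

normal : ∀ {p} → List (Signed p) → List (∃ (Removable p))
normal []              = []
normal (minus x r ∷ w) = (x , r) ∷ normal w
normal (plus _ _ ∷ w)  = normal w

remove : ∀ p → ∃ (Removable p) → Partition
remove _ (_ , _ , q , _) = q

add : ∀ p → ∃ (Addable p) → Partition
add _ (_ , _ , q , _) = q

-- All positions in a rectangle containing p and its addable boxes, rows from
-- bottom to top and each row from left to right.
positions : Partition → List Box
positions p = cartesianProduct (downFrom (suc (length (parts p)))) (upTo (suc (part p 0)))

module _ (ℓ : ℕ) .{{_ : NonZero ℓ}} where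

  residue : Box → ℕ
  residue (a , b) = (ℤ.+ b ℤ.- ℤ.+ a) %ℕ ℓ

  sign : ℕ → (p : Partition) → Box → Maybe (Signed p)
  sign i p x with residue x ≟ i | removable? p x | addable? p x
  ... | no _  | _     | _     = nothing
  ... | yes _ | yes r | _     = just (minus x r)
  ... | yes _ | no _  | yes s = just (plus x s)
  ... | yes _ | no _  | no _  = nothing

  signature : ℕ → (p : Partition) → List (Signed p)
  signature i p = mapMaybe (sign i p) (positions p)

  reducedSignature : ℕ → (p : Partition) → List (Signed p)
  reducedSignature i p = reduce (signature i p)

  normalBoxes : ℕ → (p : Partition) → List (∃ (Removable p))
  normalBoxes i p = normal (reducedSignature i p)

  conormalBoxes : ℕ → (p : Partition) → List (∃ (Addable p))
  conormalBoxes i p = conormal (reducedSignature i p)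

  εᵢ : ℕ → Partition → ℕ
  εᵢ i p = length (normalBoxes i p)

  φᵢ : ℕ → Partition → ℕ
  φᵢ i p = length (conormalBoxes i p)

  -- In the crystal operators, nothing stands for 0.
  ẽ : ℕ → Partition → Maybe Partition
  ẽ i p = Maybe.map (remove p) (head (normalBoxes i p))

  f̃ : ℕ → Partition → Maybe Partition
  f̃ i p = Maybe.map (add p) (last (conormalBoxes i p))

-- The n-fold composite of a partial operator.
power : {A : Set} → (A → Maybe A) → ℕ → A → Maybe A
power f zero    x = just x
power f (suc n) x = f x >>= power f n

{-# OPTIONS --safe #-}
-- Encode p by its abacus: row a is a bead at position part p a - a (shifted by N so as to be a natural number).
-- Removing an ℓ-rim hook moves a bead from x to a gap at x - ℓ, and the hook is horizontal iff no bead lies strictly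
-- between.  Hence p is an ℓ-partition iff, for every gap g below some bead congruent to g mod ℓ, all beads above g
-- are congruent to g (all hook lengths in a column are divisible by ℓ, or none is).  Under this condition a removable
-- i-box never precedes an addable one in the i-signature, so nothing cancels, and the maximal powers of f̃ and ẽ add
-- all addable, respectively remove all removable, i-boxes.  They permute beads inside the pairs of neighbouring
-- positions c, c + 1 of one residue class, and the condition on gaps survives this.
module Submission where

open import Defs
open import Data.Empty using (⊥; ⊥-elim)
open import Data.Integer as ℤ using (-[1+_])
open import Data.Integer.DivMod using (_/ℕ_; a≡a%ℕn+[a/ℕn]*n; n%ℕd<d)
import Data.Integer.Properties as ℤ
import Data.Integer.Tactic.RingSolver as ℤSolver
open import Data.List using (List; []; _∷_; [_]; length; map; filter; mapMaybe; cartesianProduct; upTo; downFrom;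
                             head; last)
import Data.List.Membership.DecPropositional as DecMembership
open import Data.List.Membership.Propositional using (_∈_; _∉_)
open import Data.List.Membership.Propositional.Properties
  using (∈-map⁺; ∈-map⁻; ∈-cartesianProduct⁺; ∈-cartesianProduct⁻; ∈-upTo⁺; ∈-downFrom⁺)
open import Data.List.Membership.Propositional.Properties.WithK using (unique∧set⇒bag)
open import Data.List.Properties using (length-map; filter-accept; filter-reject)
open import Data.List.Relation.Binary.BagAndSetEquality using (∼bag⇒↭)
open import Data.List.Relation.Binary.Permutation.Propositional.Properties using (↭-length)
open import Data.List.Relation.Unary.All as All using (All; []; _∷_)
open import Data.List.Relation.Unary.AllPairs as AllPairs using (AllPairs; []; _∷_)
import Data.List.Relation.Unary.AllPairs.Properties as AllPairs
open import Data.List.Relation.Unary.Any using (here; there)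
open import Data.List.Relation.Unary.Linked as Linked using (Linked; []; [-]; _∷_)
open import Data.List.Relation.Unary.Linked.Properties using (Linked⇒AllPairs)
open import Data.List.Relation.Unary.Unique.Propositional using (Unique)
open import Data.Maybe as Maybe using (Maybe; just; nothing; _>>=_)
open import Data.Maybe.Properties using (just-injective)
open import Data.Maybe.Relation.Unary.Any using (Any; just)
open import Data.Nat using (ℕ; zero; suc; pred; _+_; _*_; _∸_; _≤_; _<_; _≥_; z≤n; s≤s; s≤s⁻¹; NonZero;
                            _≟_; _<?_; _≤?_; _%_; _/_)
open import Data.Nat.DivMod using (m≡m%n+[m/n]*n; %-distribˡ-+; [m+n]%n≡m%n; [m+kn]%n≡m%n; m<n⇒m%n≡m)
open import Data.Nat.Properties
open import Data.Nat.Tactic.RingSolver using (solve-∀)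
open import Data.Product using (∃; _×_; _,_; proj₁; proj₂)
open import Data.Product.Properties using (≡-dec)
open import Data.Sum as Sum using (_⊎_; inj₁; inj₂; [_,_]′)
open import Data.Unit using (⊤; tt)
open import Function using (_∘_; id; flip)
open import Function.Bundles using (mk⇔; module Equivalence)
open Equivalence using (to; from)
open import Relation.Binary.Construct.Closure.ReflexiveTransitive using (Star; ε; _◅_)
open import Relation.Binary.Definitions using (tri<; tri≈; tri>)
open import Relation.Binary.PropositionalEquality using (_≡_; _≢_; refl; sym; trans; cong; subst; subst₂)
open import Relation.Nullary using (Dec; yes; no; ¬_)

-- Beads are recorded by the function that counts the beads at or above each position. A removable
-- rim hook has one box on each of ℓ consecutive diagonals, and its removal lowers this function by
-- one on exactly these ℓ indices.
--
-- The obstacle is that the condition on gaps does not pass through single crystal operators. For ℓ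
-- = 3 and i = 1 the first step from (4,2) leads to (5,2), which is not a 3-partition: removing its
-- horizontal hook leaves (2,2). The powers are therefore followed by two weaker invariants: no
-- removable i-box precedes an addable one (`Separated`), and the counts at positions not congruent
-- to i + 1 never change (`Agree`). The condition on gaps is transferred only once, from the first
-- partition to the last.
--
-- The shift N must be a multiple of ℓ for residues to be visible in positions, and at least the
-- number of rows of the last partition. Since that partition is not known in advance, the condition
-- is carried for all multiples of ℓ.

-- Abaci as counting functions, and the move of one bead

-- r z is to be read as the number of beads at positions z and above.
Bead Gap : (ℕ → ℕ) → ℕ → Set
Bead r z = r z ≡ suc (r (suc z))
Gap  r z = r z ≡ r (suc z)

Staircase : (ℕ → ℕ) → Set
Staircase r = ∀ z → Bead r z ⊎ Gap r z

¬bead∧gap : ∀ r z → Bead r z → Gap r z → ⊥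
¬bead∧gap _ _ b g = 1+n≢n (trans (sym b) g)

staircase-antitone : ∀ {r} → Staircase r → ∀ {m n} → m ≤ n → r n ≤ r m
staircase-antitone {r} st {m} m≤n = subst (λ k → r k ≤ r m) (m+[n∸m]≡n m≤n) (go _)
  where
  go : ∀ k → r (m + k) ≤ r m
  go zero rewrite +-identityʳ m = ≤-refl
  go (suc k) rewrite +-suc m k with st (m + k)
  ... | inj₁ b = ≤-trans (n≤1+n _) (≤-trans (≤-reflexive (sym b)) (go k))
  ... | inj₂ g = ≤-trans (≤-reflexive (sym g)) (go k)

bead-cong : ∀ r r′ z → r z ≡ r′ z → r (suc z) ≡ r′ (suc z) → Bead r z → Bead r′ z
bead-cong _ _ _ e e′ b = trans (sym e) (trans b (cong suc e′))

gap-cong : ∀ r r′ z → r z ≡ r′ z → r (suc z) ≡ r′ (suc z) → Gap r z → Gap r′ z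
gap-cong _ _ _ e e′ g = trans (sym e) (trans g e′)

-- A bead leaves `x` and arrives at the lower position `g`, in terms of counts.
record Moved (r r′ : ℕ → ℕ) (g x : ℕ) : Set where
  field
    g<x     : g < x
    between : ∀ {t} → g < t → t ≤ x → r t ≡ suc (r′ t)
    below   : ∀ {t} → t ≤ g → r t ≡ r′ t
    above   : ∀ {t} → x < t → r t ≡ r′ t

module _ {r r′ : ℕ → ℕ} (st : Staircase r) (st′ : Staircase r′) {g x : ℕ} (mv : Moved r r′ g x) where
  open Moved mv

  moved-bead : Bead r x
  moved-bead with st x
  ... | inj₁ b = b
  ... | inj₂ h = ⊥-elim (<⇒≱ (≤-reflexive (trans (sym (between g<x ≤-refl)) (trans h (above ≤-refl))))
                          (staircase-antitone st′ (n≤1+n x)))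

  moved-gap : Gap r g
  moved-gap with st g
  ... | inj₂ h = h
  ... | inj₁ b = ⊥-elim (2+≰ st′ (trans (sym (below ≤-refl)) (trans b (cong suc (between ≤-refl g<x)))))
    where
    2+≰ : ∀ {r z} → Staircase r → r z ≢ suc (suc (r (suc z)))
    2+≰ {z = z} st e with st z
    ... | inj₁ b = 1+n≢n (suc-injective (trans (sym e) b))
    ... | inj₂ h = <-irrefl (trans (sym h) e) (m<n⇒m<1+n ≤-refl)

  moved-bead⁻ : ∀ {z} → Bead r′ z → Bead r z ⊎ z ≡ g
  moved-bead⁻ {z} b with <-cmp z g | <-cmp z x
  ... | tri≈ _ e _  | _ = inj₂ e
  ... | tri< l _ _  | _ = inj₁ (bead-cong r′ r z (sym (below (<⇒≤ l))) (sym (below l)) b)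
  ... | tri> _ _ l  | tri< l′ _ _ =
        inj₁ (trans (between l (<⇒≤ l′)) (cong suc (trans b (sym (between (m<n⇒m<1+n l) l′)))))
  ... | tri> _ _ l  | tri≈ _ refl _ = inj₁ moved-bead
  ... | tri> _ _ l  | tri> _ _ l′ = inj₁ (bead-cong r′ r z (sym (above l′)) (sym (above (m<n⇒m<1+n l′))) b)

  moved-gap⁻ : ∀ {z} → Gap r′ z → Gap r z ⊎ z ≡ x
  moved-gap⁻ {z} h with <-cmp z g | <-cmp z x
  ... | tri≈ _ refl _ | _ = inj₁ moved-gap
  ... | tri< l _ _  | _ = inj₁ (gap-cong r′ r z (sym (below (<⇒≤ l))) (sym (below l)) h)
  ... | tri> _ _ l  | tri< l′ _ _ =
        inj₁ (trans (between l (<⇒≤ l′)) (trans (cong suc h) (sym (between (m<n⇒m<1+n l) l′))))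
  ... | tri> _ _ l  | tri≈ _ e _ = inj₂ e
  ... | tri> _ _ l  | tri> _ _ l′ = inj₁ (gap-cong r′ r z (sym (above l′)) (sym (above (m<n⇒m<1+n l′))) h)

  moved-bead⁺ : ∀ {z} → Bead r z → z ≢ x → Bead r′ z
  moved-bead⁺ {z} b z≢x with <-cmp z g | <-cmp z x
  ... | tri< l _ _    | _ = bead-cong r r′ z (below (<⇒≤ l)) (below l) b
  ... | tri≈ _ refl _ | _ = ⊥-elim (¬bead∧gap r z b moved-gap)
  ... | tri> _ _ l  | tri< l′ _ _ = suc-injective
        (trans (sym (between l (<⇒≤ l′))) (trans b (cong suc (between (m<n⇒m<1+n l) l′))))
  ... | tri> _ _ _  | tri≈ _ e _ = ⊥-elim (z≢x e)
  ... | tri> _ _ _  | tri> _ _ l′ = bead-cong r r′ z (above l′) (above (m<n⇒m<1+n l′)) b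

  moved-new : Bead r′ g
  moved-new = trans (sym (below ≤-refl)) (trans moved-gap (between ≤-refl g<x))

-- Congruence of positions and the condition on gaps

module Residues (ℓ : ℕ) .{{_ : NonZero ℓ}} (2≤ℓ : 2 ≤ ℓ) where

  infix 4 _≋_

  _≋_ : ℕ → ℕ → Set
  x ≋ y = x % ℓ ≡ y % ℓ

  ≋⇒apart : ∀ {g x} → g < x → x ≋ g → g + ℓ ≤ x
  ≋⇒apart {g} {x} g<x e with x / ℓ ≤? g / ℓ
  ... | yes q = ⊥-elim (<⇒≱ g<x (begin
        x                     ≡⟨ m≡m%n+[m/n]*n x ℓ ⟩
        x % ℓ + (x / ℓ) * ℓ   ≤⟨ +-mono-≤ (≤-reflexive e) (*-monoˡ-≤ ℓ q) ⟩
        g % ℓ + (g / ℓ) * ℓ   ≡⟨ m≡m%n+[m/n]*n g ℓ ⟨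
        g                     ∎))
    where open ≤-Reasoning
  ... | no q = begin
        g + ℓ                       ≡⟨ cong (_+ ℓ) (m≡m%n+[m/n]*n g ℓ) ⟩
        g % ℓ + (g / ℓ) * ℓ + ℓ     ≡⟨ +-assoc (g % ℓ) _ ℓ ⟩
        g % ℓ + ((g / ℓ) * ℓ + ℓ)   ≡⟨ cong (g % ℓ +_) (+-comm _ ℓ) ⟩
        g % ℓ + suc (g / ℓ) * ℓ     ≤⟨ +-mono-≤ (≤-reflexive (sym e)) (*-monoˡ-≤ ℓ (≰⇒> q)) ⟩
        x % ℓ + (x / ℓ) * ℓ         ≡⟨ m≡m%n+[m/n]*n x ℓ ⟨
        x                           ∎
    where open ≤-Reasoning

  apart⇒1+< : ∀ {g x} → g + ℓ ≤ x → suc g < x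
  apart⇒1+< {g} le = ≤-trans (≤-trans (≤-reflexive (+-comm 2 g)) (+-monoʳ-≤ g 2≤ℓ)) le

  suc-≋̸ : ∀ c → ¬ (suc c ≋ c)
  suc-≋̸ c e = <-irrefl refl (apart⇒1+< (≋⇒apart (n<1+n c) e))

  +-≋ : ∀ {m n} k → m ≋ n → m + k ≋ n + k
  +-≋ {m} {n} k e = trans (%-distribˡ-+ m k ℓ)
    (trans (cong (λ z → (z + k % ℓ) % ℓ) e) (sym (%-distribˡ-+ n k ℓ)))

  suc-≋ : ∀ {m n} → m ≋ n → suc m ≋ suc n
  suc-≋ {m} {n} e = subst₂ _≋_ (+-comm m 1) (+-comm n 1) (+-≋ 1 e)

  suc-≋⁻ : ∀ {m n} → suc m ≋ suc n → m ≋ n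
  suc-≋⁻ {m} {n} e = trans (sym (wrap m)) (trans (+-≋ (ℓ ∸ 1) e) (wrap n))
    where
    wrap : ∀ m → suc m + (ℓ ∸ 1) ≋ m
    wrap m = trans (cong (_% ℓ) (trans (sym (+-suc m (ℓ ∸ 1)))
                     (cong (m +_) (m+[n∸m]≡n (≤-trans (n≤1+n 1) 2≤ℓ)))))
                   ([m+n]%n≡m%n m ℓ)

  -- Carter's condition in abacus form: the beads above a fixed gap are the boxes of one column,
  -- with hook length the distance to the gap.
  Carter : (ℕ → ℕ) → Set
  Carter r = ∀ {g x y} → g < x → g < y → Gap r g → Bead r x → Bead r y → x ≋ g → y ≋ g

  module _ {r r′ : ℕ → ℕ} (st : Staircase r) (st′ : Staircase r′) {g : ℕ}
           (mv : Moved r r′ g (g + ℓ)) (carter : Carter r) where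
    private
      g<x = Moved.g<x mv
      x≋g : g + ℓ ≋ g
      x≋g = [m+n]%n≡m%n g ℓ
      gap-g = moved-gap st st′ mv
      bead-x = moved-bead st st′ mv

    -- The move stays in one residue class. The new gap `g + ℓ` is answered by the old gap `g`, and
    -- the new bead `g` is replaced by the old bead `g + ℓ`, which lies above every gap below `g`.
    carter-moved : Carter r′
    carter-moved {h} {a} {b} h<a h<b gap ba bb a≋h
      with moved-gap⁻ st st′ mv gap | moved-bead⁻ st st′ mv ba | moved-bead⁻ st st′ mv bb
    ... | inj₂ refl | _ | inj₁ b′ = trans (carter g<x (<-trans g<x h<b) gap-g bead-x b′ x≋g) (sym x≋g)
    ... | inj₂ refl | _ | inj₂ refl = ⊥-elim (<-asym g<x h<b)
    ... | inj₁ h′ | inj₁ a′ | inj₁ b′ = carter h<a h<b h′ a′ b′ a≋h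
    ... | inj₁ h′ | inj₁ a′ | inj₂ refl =
          trans (sym x≋g) (carter h<a (<-trans h<b g<x) h′ a′ bead-x a≋h)
    ... | inj₁ h′ | inj₂ refl | inj₁ b′ = carter (<-trans h<a g<x) h<b h′ bead-x b′ (trans x≋g a≋h)
    ... | inj₁ h′ | inj₂ refl | inj₂ refl = a≋h

    -- A bead strictly between `g` and `g + ℓ` would have to be congruent to `g`, yet it is less
    -- than ℓ away.
    carter-flat : ∀ {t} → g < t → t ≤ g + ℓ → r t ≡ r (g + ℓ)
    carter-flat {t} g<t t≤x = go (g + ℓ ∸ t) t (m+[n∸m]≡n t≤x) g<t
      where
      go : ∀ k t → t + k ≡ g + ℓ → g < t → r t ≡ r (g + ℓ)
      go zero    t e _ = cong r (trans (sym (+-identityʳ t)) e)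
      go (suc k) t e l with st t
      ... | inj₂ h = trans h (go k (suc t) (trans (sym (+-suc t k)) e) (m<n⇒m<1+n l))
      ... | inj₁ b = ⊥-elim (<⇒≱ (≤-trans (m<m+n t (s≤s z≤n)) (≤-reflexive e))
                       (≋⇒apart l (carter g<x l gap-g bead-x b x≋g)))

  -- r′ arises from r by sorting each pair c, c + 1 with c + 1 ≋ j: u c is occupied in r′ iff both positions are in r,
  -- and v c iff one of them is.
  module Transfer {r r′ : ℕ → ℕ} (carter : Carter r) (j : ℕ) (same : ∀ t → ¬ (t ≋ j) → r t ≡ r′ t)
    (bead₀ : Bead r′ 0) (u v : ℕ → ℕ) (uv : (∀ c → u c ≡ c × v c ≡ suc c) ⊎ (∀ c → u c ≡ suc c × v c ≡ c))
    (u-bead : ∀ c → suc c ≋ j → Bead r′ (u c) → Bead r c × Bead r (suc c))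
    (v-bead : ∀ c → suc c ≋ j → Bead r′ (v c) → Bead r c ⊎ Bead r (suc c))
    (u-gap : ∀ c → suc c ≋ j → Gap r′ (u c) → Gap r c ⊎ Gap r (suc c))
    (v-gap : ∀ c → suc c ≋ j → Gap r′ (v c) → Gap r c × Gap r (suc c)) where

    data View (z : ℕ) : Set where
      atU   : ∀ c → suc c ≋ j → z ≡ u c → View z
      atV   : ∀ c → suc c ≋ j → z ≡ v c → View z
      other : ¬ (z ≋ j) → ¬ (suc z ≋ j) → View z

    low-view : ∀ {c} → suc c ≋ j → View c
    low-view {c} e = [ (λ f → atU c e (sym (proj₁ (f c)))) , (λ f → atV c e (sym (proj₂ (f c)))) ]′ uv

    high-view : ∀ {c} → suc c ≋ j → View (suc c)
    high-view {c} e = [ (λ f → atV c e (sym (proj₂ (f c)))) , (λ f → atU c e (sym (proj₁ (f c)))) ]′ uv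

    -- Position 0 is left out, since it could be the upper member of a pair without a lower one. A
    -- gap at 0 is excluded by `bead₀`, and whatever lies above a gap is a successor.
    view : ∀ z → View (suc z)
    view z with suc z % ℓ ≟ j % ℓ | suc (suc z) % ℓ ≟ j % ℓ
    ... | yes e | _     = high-view e
    ... | no _  | yes e = low-view e
    ... | no n  | no m  = other n m

    view> : ∀ {g z} → g < z → View z
    view> (s≤s _) = view _

    Near : (ℕ → ℕ) → Set
    Near w = (∀ c → w c ≡ c) ⊎ (∀ c → w c ≡ suc c)

    near-u : Near u
    near-u = Sum.map (λ f c → proj₁ (f c)) (λ f c → proj₁ (f c)) uv

    near-v : Near v
    near-v = Sum.swap (Sum.map (λ f c → proj₂ (f c)) (λ f c → proj₂ (f c)) uv)

    near-≤ : ∀ {w} → Near w → ∀ c → c ≤ w c × w c ≤ suc c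
    near-≤ (inj₁ f) c rewrite f c = ≤-refl , n≤1+n c
    near-≤ (inj₂ f) c rewrite f c = n≤1+n c , ≤-refl

    near-< : ∀ {w} → Near w → ∀ {c d} → w c < w d → c < d
    near-< (inj₁ f) {c} {d} l rewrite f c | f d = l
    near-< (inj₂ f) {c} {d} l rewrite f c | f d = s≤s⁻¹ l

    near-≋ : ∀ {w} → Near w → ∀ {c d} → suc c ≋ j → suc d ≋ j → w d ≋ w c
    near-≋ (inj₁ f) {c} {d} e e′ rewrite f c | f d = suc-≋⁻ (trans e′ (sym e))
    near-≋ (inj₂ f) {c} {d} e e′ rewrite f c | f d = trans e′ (sym e)

    near-other : ∀ {w} → Near w → ∀ {c z} → suc c ≋ j → ¬ (z ≋ j) → ¬ (suc z ≋ j) → ¬ (z ≋ w c)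
    near-other (inj₁ f) {c} e n m e′ rewrite f c = m (trans (suc-≋ e′) e)
    near-other (inj₂ f) {c} e n m e′ rewrite f c = n (trans e′ e)

    u-≋̸-v : ∀ {c d} → suc c ≋ j → suc d ≋ j → ¬ (u c ≋ v d)
    u-≋̸-v {c} e e′ h = [ (λ f → suc-≋̸ c (sym (subst₂ _≋_ (proj₁ (f c)) (proj₂ (f c)) k)))
                        , (λ f → suc-≋̸ c (subst₂ _≋_ (proj₁ (f c)) (proj₂ (f c)) k)) ]′ uv
      where
      k : u c ≋ v c
      k = trans h (near-≋ near-v e e′)

    apart : ∀ {c d} → suc c ≋ j → suc d ≋ j → c < d → suc c < d
    apart e e′ l = apart⇒1+< (≋⇒apart l (suc-≋⁻ (trans e′ (sym e))))

    other-bead : ∀ {z} → ¬ (z ≋ j) → ¬ (suc z ≋ j) → Bead r′ z → Bead r z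
    other-bead {z} n m = bead-cong r′ r z (sym (same z n)) (sym (same (suc z) m))

    -- By `Carter r`, a gap of `r` in a pair never lies below beads of both residues of a pair. A
    -- gap at `u c` below a bead at `u d` would violate this, as both positions of the pair `d` are
    -- occupied in `r`. A gap at `v c` means two gaps in `r`; a bead at `v d` makes one of them bind
    -- all beads above, which leaves only beads at further `v f`. A gap outside the pairs was
    -- already in `r`, and a bead in a pair above it would come from one of a wrong residue.
    carter′ : Carter r′
    carter′ {zero} _ _ gap _ _ _ = ⊥-elim (¬bead∧gap r′ 0 bead₀ gap)
    carter′ {suc g} {x} {y} g<x g<y gap bx by x≋g with view g | view> g<x | view> g<y
    ... | other n m | _ | vy = absurd-or vy
      where
      at-g : Gap r (suc g)
      at-g = gap-cong r′ r (suc g) (sym (same _ n)) (sym (same _ m)) gap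
      bead-x : Bead r x
      bead-x = other-bead (λ e → n (trans (sym x≋g) e)) (λ e → m (trans (sym (suc-≋ x≋g)) e)) bx
      >g : ∀ {w c} → Near w → suc c ≋ j → suc g < w c → suc g < c
      >g {w} {c} near e l = ≤∧≢⇒< (s≤s⁻¹ (≤-trans l (proj₂ (near-≤ near c)))) λ { refl → m e }
      low : ∀ {c} → suc c ≋ j → suc g < c → ¬ Bead r c
      low e l b = near-other (inj₁ λ _ → refl) e n m (sym (carter g<x l at-g bead-x b x≋g))
      high : ∀ {c} → suc c ≋ j → suc g < c → ¬ Bead r (suc c)
      high e l b = near-other (inj₂ λ _ → refl) e n m (sym (carter g<x (m<n⇒m<1+n l) at-g bead-x b x≋g))
      absurd-or : View y → y ≋ suc g
      absurd-or (other n′ m′)    = carter g<x g<y at-g bead-x (other-bead n′ m′ by) x≋g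
      absurd-or (atU c e refl) = ⊥-elim (low e (>g near-u e g<y) (proj₁ (u-bead c e by)))
      absurd-or (atV c e refl) with v-bead c e by
      ... | inj₁ b = ⊥-elim (low e (>g near-v e g<y) b)
      ... | inj₂ b = ⊥-elim (high e (>g near-v e g<y) b)
    ... | atU c e g≡ | other n m | _ = ⊥-elim (near-other near-u e n m (trans x≋g (cong (_% ℓ) g≡)))
    ... | atU c e g≡ | atV d e′ refl | _ = ⊥-elim (u-≋̸-v e e′ (trans (cong (_% ℓ) (sym g≡)) (sym x≋g)))
    ... | atU c e g≡ | atU d e′ refl | _ = ⊥-elim (absurd (u-gap c e (subst (Gap r′) g≡ gap)))
      where
      c<d : c < d
      c<d = near-< near-u (subst (_< u d) g≡ g<x)
      bs = u-bead d e′ bx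
      d≋c : d ≋ c
      d≋c = suc-≋⁻ (trans e′ (sym e))
      absurd : Gap r c ⊎ Gap r (suc c) → ⊥
      absurd (inj₁ h) = suc-≋̸ d (trans (carter c<d (m<n⇒m<1+n c<d) h (proj₁ bs) (proj₂ bs) d≋c) (sym d≋c))
      absurd (inj₂ h) = suc-≋̸ d (trans e′ (trans (sym e)
        (sym (carter (s≤s c<d) (apart e e′ c<d) h (proj₂ bs) (proj₁ bs) (trans e′ (sym e))))))
    ... | atV c e g≡ | other n m | _ = ⊥-elim (near-other near-v e n m (trans x≋g (cong (_% ℓ) g≡)))
    ... | atV c e g≡ | atU d e′ refl | _ = ⊥-elim (u-≋̸-v e′ e (trans x≋g (cong (_% ℓ) g≡)))
    ... | atV c e g≡ | atV d e′ refl | vy = result vy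
      where
      gaps = v-gap c e (subst (Gap r′) g≡ gap)
      c<d : c < d
      c<d = near-< near-v (subst (_< v d) g≡ g<x)
      c<y : c < y
      c<y = ≤-trans (s≤s (≤-trans (proj₁ (near-≤ near-v c)) (≤-reflexive (sym g≡)))) g<y
      low : ∀ {z} → c < z → Bead r d → Bead r z → z ≋ c
      low l b bz = carter c<d l (proj₁ gaps) b bz (suc-≋⁻ (trans e′ (sym e)))
      high : ∀ {z} → suc c < z → Bead r (suc d) → Bead r z → z ≋ suc c
      high l b bz = carter (s≤s c<d) l (proj₂ gaps) b bz (trans e′ (sym e))
      result : View y → y ≋ suc g
      result (atV f e″ refl) = trans (near-≋ near-v e e″) (cong (_% ℓ) (sym g≡))
      result (other n m) with v-bead d e′ bx
      ... | inj₁ b = ⊥-elim (m (trans (suc-≋ (low c<y b (other-bead n m by))) e))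
      ... | inj₂ b = ⊥-elim (n (trans (high (≤∧≢⇒< c<y λ { refl → n e }) b (other-bead n m by)) e))
      result (atU f e″ refl) with u-bead f e″ by | v-bead d e′ bx
      ... | b₀ , b₁ | bd = ⊥-elim (contra bd)
        where
        c<f : c < f
        c<f = ≤∧≢⇒< (s≤s⁻¹ (≤-trans c<y (proj₂ (near-≤ near-u f)))) λ { refl → ¬bead∧gap r c b₀ (proj₁ gaps) }
        contra : Bead r d ⊎ Bead r (suc d) → ⊥
        contra (inj₁ b) = suc-≋̸ f (trans (low (m<n⇒m<1+n c<f) b b₁) (suc-≋⁻ (trans e (sym e″))))
        contra (inj₂ b) = suc-≋̸ f (trans e″ (trans (sym e) (sym (high (apart e e″ c<f) b b₀))))

-- Parts of a partition and equalities of diagrams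

entry-antitone : ∀ xs → (∀ a → entry xs (suc a) ≤ entry xs a) → ∀ {a b} → a ≤ b → entry xs b ≤ entry xs a
entry-antitone xs mono {a} {b} a≤b = subst (λ c → entry xs c ≤ entry xs a) (m+[n∸m]≡n a≤b) (go _)
  where
  go : ∀ k → entry xs (a + k) ≤ entry xs a
  go zero    = ≤-reflexive (cong (entry xs) (+-identityʳ a))
  go (suc k) = ≤-trans (≤-reflexive (cong (entry xs) (+-suc a k))) (≤-trans (mono (a + k)) (go k))

part-antitone : ∀ p {a b} → a ≤ b → part p b ≤ part p a
part-antitone p = entry-antitone (parts p) (part-mono p)

entry-beyond : ∀ xs a → length xs ≤ a → entry xs a ≡ 0
entry-beyond []       _       _       = refl
entry-beyond (_ ∷ xs) (suc a) (s≤s h) = entry-beyond xs a h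

∖⇒part-≤ : ∀ p q {xs} → q ≐ p ∖ xs → ∀ a → part q a ≤ part p a
∖⇒part-≤ p q q≐ a = ≮⇒≥ λ l → <-irrefl refl (proj₁ (to (q≐ (a , _)) l))

∖[]⇒∉ : ∀ p q {y} → q ≐ p ∖ [ y ] → y ∉ᵈ q
∖[]⇒∉ p q q≐ h = proj₂ (to (q≐ _) h) (here refl)

∪⇒∖ : ∀ p q {y} → y ∉ᵈ p → q ≐ p ∪ y → p ≐ q ∖ [ y ]
∪⇒∖ p q {y} y∉p q≐ z = mk⇔
  (λ h → from (q≐ z) (inj₁ h) , λ { (here refl) → y∉p h })
  (λ (h , z∉) → [ id , (λ e → ⊥-elim (z∉ (here e))) ]′ (to (q≐ z) h))

least-failure : ∀ {P : ℕ → Set} → (∀ a → Dec (P a)) → (∀ {a b} → a ≤ b → P b → P a) → ∀ n → ¬ P n →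
                ∃ λ r → (∀ {a} → a < r → P a) × (∀ {a} → P a → a < r)
least-failure P? closed zero ¬p = 0 , (λ ()) , λ {a} h → ⊥-elim (¬p (closed z≤n h))
least-failure P? closed (suc n) ¬p with P? n
... | yes h = suc n , (λ l → closed (s≤s⁻¹ l) h) , λ {a} k → ≰⇒> λ l → ¬p (closed l k)
... | no ¬h = least-failure P? closed n ¬h

-- The abacus of a partition

module Abacus (N : ℕ) where

  -- Removing a box of index t takes a bead from t to t - 1.
  Index : ℕ → Box → Set
  Index t (a , b) = suc (b + N) ≡ t + a

  abstract
    private
      -- Row `a` carries the bead `part p a + N - a`. The rows whose bead is at or above `t` form an
      -- initial segment, so their number is the first row that fails.
      ranked : ∀ p t → ∃ λ r → (∀ {a} → a < r → t + a ≤ part p a + N) × (∀ {a} → t + a ≤ part p a + N → a < r)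
      ranked p t = least-failure (λ a → t + a ≤? part p a + N)
        (λ {a} {b} a≤b h → ≤-trans (+-monoʳ-≤ t a≤b) (≤-trans h (+-monoˡ-≤ N (part-antitone p a≤b))))
        -- A row below all parts and beyond `N`: the inequality fails there even for `t = 0`.
        (suc (length (parts p) + N))
        λ h → <⇒≱ (≤-trans (s≤s (≤-trans (m≤n+m N _) (m≤n+m _ t))) (≤-reflexive (sym (+-suc t _))))
               (≤-trans h (≤-reflexive (cong (_+ N)
                 (entry-beyond (parts p) _ (≤-trans (m≤m+n _ N) (n≤1+n _))))))

    rank : Partition → ℕ → ℕ
    rank p t = proj₁ (ranked p t)

    <rank⇒ : ∀ p t {a} → a < rank p t → t + a ≤ part p a + N
    <rank⇒ p t = proj₁ (proj₂ (ranked p t))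

    ⇒<rank : ∀ p t {a} → t + a ≤ part p a + N → a < rank p t
    ⇒<rank p t = proj₂ (proj₂ (ranked p t))

  -- Bead positions decrease strictly from row to row, so at most one row has its bead at `t`.
  rank-staircase : ∀ p → Staircase (rank p)
  rank-staircase p t with m≤n⇒m<n∨m≡n (≮⇒≥ {rank p t} {rank p (suc t)} λ l →
      <-irrefl refl (⇒<rank p t (≤-trans (n≤1+n _) (<rank⇒ p (suc t) l))))
  ... | inj₂ e = inj₂ (sym e)
  ... | inj₁ l = inj₁ (≤-antisym (≮⇒≥ λ l′ → <-irrefl refl (⇒<rank p (suc t)
      (≤-trans (≤-reflexive (sym (+-suc t _)))
        (≤-trans (<rank⇒ p t l′) (+-monoˡ-≤ N (part-mono p _)))))) l)

  rank-antitone : ∀ p {s t} → s ≤ t → rank p t ≤ rank p s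
  rank-antitone p = staircase-antitone (rank-staircase p)

  -- The beads above `z` belong to the earlier rows, so their number is the row of the bead at `z`.
  bead⇒part : ∀ p z → Bead (rank p) z → part p (rank p (suc z)) + N ≡ z + rank p (suc z)
  bead⇒part p z b = ≤-antisym (s≤s⁻¹ (≰⇒> λ h → <-irrefl refl (⇒<rank p (suc z) h)))
    (<rank⇒ p z (≤-reflexive (sym b)))

  part⇒rank : ∀ p {z a} → part p a + N ≡ z + a → rank p (suc z) ≡ a × rank p z ≡ suc a
  part⇒rank p {z} {a} e with rank-staircase p z
  ... | inj₂ g = ⊥-elim (<⇒≱ (≤-trans a< (≤-reflexive g)) ≤a)
    where
    a< : a < rank p z
    a< = ⇒<rank p z (≤-reflexive (sym e))
    ≤a : rank p (suc z) ≤ a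
    ≤a = ≮⇒≥ λ l → <-irrefl (sym e) (<rank⇒ p (suc z) l)
  ... | inj₁ b = rank≡ , trans b (cong suc rank≡)
    where
    a< : a < rank p z
    a< = ⇒<rank p z (≤-reflexive (sym e))
    ≤a : rank p (suc z) ≤ a
    ≤a = ≮⇒≥ λ l → <-irrefl (sym e) (<rank⇒ p (suc z) l)
    rank≡ : rank p (suc z) ≡ a
    rank≡ = ≤-antisym ≤a (s≤s⁻¹ (≤-trans a< (≤-reflexive b)))

  part⇒bead : ∀ p {z a} → part p a + N ≡ z + a → Bead (rank p) z
  part⇒bead p e with part⇒rank p e
  ... | e′ , e″ = trans e″ (cong suc (sym e′))

  ∈⇒<rank : ∀ p {t a b} → Index t (a , b) → (a , b) ∈ᵈ p → a < rank p t
  ∈⇒<rank p {t} ix h = ⇒<rank p t (≤-trans (≤-reflexive (sym ix)) (+-monoˡ-≤ N h))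

  <rank⇒∈ : ∀ p {t a b} → Index t (a , b) → a < rank p t → (a , b) ∈ᵈ p
  <rank⇒∈ p {t} ix l = +-cancelʳ-≤ N _ _ (≤-trans (≤-reflexive ix) (<rank⇒ p t l))

  index-box : ∀ t a → t + a ≤ N ⊎ ∃ λ b → Index t (a , b)
  index-box t a with t + a ≤? N
  ... | yes l = inj₁ l
  ... | no ¬l = inj₂ (t + a ∸ suc N , trans (sym (+-suc _ N)) (m∸n+n≡m (≰⇒> ¬l)))

  -- Rows with t + a ≤ N have no box of index t; they count in every rank.
  rank-box : ∀ p q {t a} → a < rank p t → ¬ (a < rank q t) →
             ∃ λ b → Index t (a , b) × (a , b) ∈ᵈ p × (a , b) ∉ᵈ q
  rank-box p q {t} {a} l n with index-box t a
  ... | inj₁ t+a≤N = ⊥-elim (n (⇒<rank q t (≤-trans t+a≤N (m≤n+m N _))))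
  ... | inj₂ (b , ix) = b , ix , <rank⇒∈ p ix l , λ h → n (∈⇒<rank q ix h)

  module _ p q {xs} (q≐ : q ≐ p ∖ xs) where

    ∖⇒rank-≤ : ∀ t → rank q t ≤ rank p t
    ∖⇒rank-≤ t = ≮⇒≥ λ l → case (rank-box q p l (<-irrefl refl))
      where
      case : ¬ ∃ λ b → Index t (rank p t , b) × (rank p t , b) ∈ᵈ q × (rank p t , b) ∉ᵈ p
      case (_ , _ , h , n) = n (proj₁ (to (q≐ _) h))

    rank-unchanged : ∀ {t} → (∀ {z} → z ∈ xs → ¬ Index t z) → rank p t ≡ rank q t
    rank-unchanged {t} none = ≤-antisym (≮⇒≥ λ l → case (rank-box p q l (<-irrefl refl))) (∖⇒rank-≤ t)
      where
      case : ¬ ∃ λ b → Index t (rank q t , b) × (rank q t , b) ∈ᵈ p × (rank q t , b) ∉ᵈ q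
      case (_ , ix , h , n) = n (from (q≐ _) (h , λ z∈ → none z∈ ix))

    module _ {t a b} (∈xs : (a , b) ∈ xs) (∈p : (a , b) ∈ᵈ p) (ix : Index t (a , b))
             (only : ∀ {z} → z ∈ xs → Index t z → z ≡ (a , b)) where

      -- The boxes on a diagonal are filled from the top without interruption, so the only one taken
      -- away is the lowest.
      rank-row : a ≡ rank q t
      rank-row with <-cmp a (rank q t)
      ... | tri≈ _ e _ = e
      ... | tri< l _ _ = ⊥-elim (proj₂ (to (q≐ _) (<rank⇒∈ q ix l)) ∈xs)
      ... | tri> _ n l with rank-box p q (<-trans l (∈⇒<rank p ix ∈p)) (<-irrefl refl)
      ...   | _ , ix′ , h , ∉q = ⊥-elim (∉q (from (q≐ _) (h , λ z∈ → n (sym (cong proj₁ (only z∈ ix′))))))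

      rank-removed : rank p t ≡ suc (rank q t)
      rank-removed = trans (≤-antisym (≮⇒≥ high) (∈⇒<rank p ix ∈p)) (cong suc rank-row)
        where
        high : ¬ (suc a < rank p t)
        high l with rank-box p q l (λ l′ → <-irrefl rank-row (<-trans (n<1+n a) l′))
        ... | _ , ix′ , h , ∉q = ∉q (from (q≐ _) (h , λ z∈ → 1+n≢n (cong proj₁ (only z∈ ix′))))

  -- If the next row were equally long, its bead would stand at `s`.
  removable-corner : ∀ p {s} → Gap (rank p) s → Bead (rank p) (suc s) →
                     ∃ λ b → Index (suc s) (rank p (suc (suc s)) , b) × RemovableCorner p (rank p (suc (suc s)) , b)
  removable-corner p {s} gap bead = case (part p r) refl
    where
    r = rank p (suc (suc s))
    below : part p (suc r) < part p r
    below = ≤∧≢⇒< (part-mono p r) λ e → ¬bead∧gap (rank p) s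
      (part⇒bead p (trans (cong (_+ N) e) (trans (bead⇒part p (suc s) bead) (sym (+-suc s r))))) gap
    case : ∀ k → part p r ≡ k → ∃ λ b → Index (suc s) (r , b) × RemovableCorner p (r , b)
    case zero    e = ⊥-elim (n≮0 (≤-trans below (≤-reflexive e)))
    case (suc b) e = b , trans (cong (_+ N) (sym e)) (bead⇒part p (suc s) bead) , e ,
                     s≤s⁻¹ (≤-trans below (≤-reflexive e))

-- Rim hooks as bead moves

-- The steps that raise the content `b - a` by one; the other two adjacencies are their reverses.
data Next : Box → Box → Set where
  right : ∀ {a b} → Next (a , b) (a , suc b)
  up    : ∀ {a b} → Next (suc a , b) (a , b)

next⇒adjacent : ∀ {x y} → Next x y → Adjacent x y
next⇒adjacent right = right
next⇒adjacent up    = up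

adjacent⇒next : ∀ {x y} → Adjacent x y → Next x y ⊎ Next y x
adjacent⇒next right = inj₁ right
adjacent⇒next left  = inj₂ right
adjacent⇒next down  = inj₂ up
adjacent⇒next up    = inj₁ up

infix 4 _≈ᶜ_

-- Equality of contents `b - a`, written without subtraction.
_≈ᶜ_ : Box → Box → Set
(a , b) ≈ᶜ (a′ , b′) = b + a′ ≡ b′ + a

next-next : ∀ {x y z} → Next x y → Next z y → x ≈ᶜ z
next-next right right = refl
next-next right up    = +-suc _ _
next-next up    right = sym (+-suc _ _)
next-next up    up    = refl

prev-prev : ∀ {x y z} → Next y x → Next y z → x ≈ᶜ z
prev-prev right right = refl
prev-prev right up    = sym (+-suc _ _)
prev-prev up    right = +-suc _ _
prev-prev up    up    = refl

-- A path that turned around would go from `x` to a neighbour and on to a different box with the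
-- content of `x`.
monotone-path : ∀ {xs} → Linked Adjacent xs → Unique xs → (∀ {x y} → x ∈ xs → y ∈ xs → x ≈ᶜ y → x ≡ y) →
                Linked Next xs ⊎ Linked (flip Next) xs
monotone-path []  _ _ = inj₁ []
monotone-path [-] _ _ = inj₁ [-]
monotone-path (adj ∷ path) ((_ ∷ x≢) ∷ unique) inj
  with adjacent⇒next adj | monotone-path path unique (λ x∈ y∈ → inj (there x∈) (there y∈))
... | inj₁ n | inj₁ ns  = inj₁ (n ∷ ns)
... | inj₂ n | inj₂ ns  = inj₂ (n ∷ ns)
... | inj₁ n | inj₂ [-] = inj₁ (n ∷ [-])
... | inj₂ n | inj₁ [-] = inj₂ (n ∷ [-])
... | inj₁ n | inj₂ (m ∷ _) with x≢z ∷ _ ← x≢ =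
      ⊥-elim (x≢z (inj (here refl) (there (there (here refl))) (next-next n m)))
... | inj₂ n | inj₁ (m ∷ _) with x≢z ∷ _ ← x≢ =
      ⊥-elim (x≢z (inj (here refl) (there (there (here refl))) (prev-prev n m)))

∈ᵈ-closed : ∀ p {a a′ b b′} → a ≤ a′ → b ≤ b′ → (a′ , b′) ∈ᵈ p → (a , b) ∈ᵈ p
∈ᵈ-closed p a≤ b≤ h = ≤-trans (s≤s b≤) (≤-trans h (part-antitone p a≤))

module _ {ℓ p} (h : RimHook ℓ p) where
  open RimHook h

  hook-∈ : ∀ {z} → z ∈ᵈ p → z ∉ᵈ remainder → z ∈ boxes
  hook-∈ {z} ∈p ∉q with DecMembership._∈?_ (≡-dec _≟_ _≟_) z boxes
  ... | yes z∈ = z∈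
  ... | no z∉  = ⊥-elim (∉q (from (removes z) (∈p , z∉)))

  hook-∉ : ∀ {z} → z ∈ boxes → z ∉ᵈ remainder
  hook-∉ z∈ h = proj₂ (to (removes _) h) z∈

  private
    -- All boxes between the two lie in `p` but not in the remainder, hence in the hook; among them
    -- is a square with `(a , b)` as its upper left box.
    square : ∀ {a b a′ b′} → (a , b) ∈ boxes → (a′ , b′) ∈ boxes → a < a′ → b < b′ → ⊥
    square {a} {b} x∈ y∈ a< b< = noSquare (a , b , x∈ , inner ≤-refl (n≤1+n b) (<⇒≤ a<) b<
                                        , inner (n≤1+n a) ≤-refl a< (<⇒≤ b<) , inner (n≤1+n a) (n≤1+n b) a< b<)
      where
      inner : ∀ {c d} → a ≤ c → b ≤ d → c ≤ _ → d ≤ _ → (c , d) ∈ boxes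
      inner a≤ b≤ ≤a ≤b = hook-∈ (∈ᵈ-closed p ≤a ≤b (All.lookup inside y∈))
                                 (λ k → hook-∉ x∈ (∈ᵈ-closed remainder a≤ b≤ k))

  hook-content-injective : ∀ {x y} → x ∈ boxes → y ∈ boxes → x ≈ᶜ y → x ≡ y
  hook-content-injective {a , b} {a′ , b′} x∈ y∈ e with <-cmp a a′
  ... | tri≈ _ refl _ = cong (a ,_) (+-cancelʳ-≡ a b b′ e)
  ... | tri< l _ _ = ⊥-elim (square x∈ y∈ l (+-cancelʳ-< a b b′ (≤-trans (+-monoʳ-< b l) (≤-reflexive e))))
  ... | tri> _ _ l = ⊥-elim (square y∈ x∈ l (+-cancelʳ-< a′ b′ b (≤-trans (+-monoʳ-< b′ l) (≤-reflexive (sym e)))))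

module _ (N : ℕ) where
  open Abacus N

  index⇒≈ᶜ : ∀ {t x y} → Index t x → Index t y → x ≈ᶜ y
  index⇒≈ᶜ {t} {a , b} {a′ , b′} e e′ = +-cancelʳ-≡ (suc N) _ _ (trans (eq₁ b a′ N)
      (trans (cong (_+ a′) e) (trans (eq₂ t a a′) (trans (cong (_+ a) (sym e′)) (sym (eq₁ b′ a N))))))
    where
    eq₁ : ∀ b a N → b + a + suc N ≡ suc (b + N) + a
    eq₁ = solve-∀
    eq₂ : ∀ t a a′ → t + a + a′ ≡ t + a′ + a
    eq₂ = solve-∀

  index-functional : ∀ {t t′ x} → Index t x → Index t′ x → t ≡ t′
  index-functional {x = a , _} e e′ = +-cancelʳ-≡ a _ _ (trans (sym e) e′)

  index-next : ∀ {t} x y → Next x y → Index t x → Index (suc t) y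
  index-next _ _ right e = cong suc e
  index-next (suc a , _) _ up e = trans e (+-suc _ a)

  record Interval (xs : List Box) (s n : ℕ) : Set where
    field
      within : ∀ {z} → z ∈ xs → ∃ λ t → s < t × t ≤ s + n × Index t z
      covers : ∀ {t} → s < t → t ≤ s + n → ∃ λ z → z ∈ xs × Index t z
  open Interval

  interval-[] : ∀ s → Interval [] s 0
  interval-[] s .within ()
  interval-[] s .covers l l′ = ⊥-elim (<⇒≱ l (≤-trans l′ (≤-reflexive (+-identityʳ s))))

  interval-bottom : ∀ {x xs s n} → Index (suc s) x → Interval xs (suc s) n → Interval (x ∷ xs) s (suc n)
  interval-bottom {s = s} {n} ix iv .within (here refl) =
    suc s , ≤-refl , ≤-trans (s≤s (m≤m+n s n)) (≤-reflexive (sym (+-suc s n))) , ix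
  interval-bottom {s = s} {n} ix iv .within (there z∈) with within iv z∈
  ... | t , l , l′ , ix′ = t , <-trans ≤-refl l , ≤-trans l′ (≤-reflexive (sym (+-suc s n))) , ix′
  interval-bottom {s = s} {n} ix iv .covers l l′ with m≤n⇒m<n∨m≡n l
  ... | inj₂ refl = _ , here refl , ix
  ... | inj₁ l″ with covers iv l″ (≤-trans l′ (≤-reflexive (+-suc s n)))
  ...   | z , z∈ , ix′ = z , there z∈ , ix′

  interval-top : ∀ {x xs s n} → Index (s + suc n) x → Interval xs s n → Interval (x ∷ xs) s (suc n)
  interval-top {s = s} {n} ix iv .within (here refl) = s + suc n , m<m+n s (s≤s z≤n) , ≤-refl , ix
  interval-top {s = s} {n} ix iv .within (there z∈) with within iv z∈
  ... | t , l , l′ , ix′ = t , l , ≤-trans l′ (+-monoʳ-≤ s (n≤1+n n)) , ix′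
  interval-top {s = s} {n} ix iv .covers l l′ with m≤n⇒m<n∨m≡n l′
  ... | inj₂ refl = _ , here refl , ix
  ... | inj₁ l″ with covers iv l (s≤s⁻¹ (≤-trans l″ (≤-reflexive (+-suc s n))))
  ...   | z , z∈ , ix′ = z , there z∈ , ix′

  ascending⇒interval : ∀ {x xs s} → Linked Next (x ∷ xs) → Index (suc s) x → Interval (x ∷ xs) s (suc (length xs))
  ascending⇒interval [-] ix = interval-bottom ix (interval-[] _)
  ascending⇒interval (n ∷ ns) ix = interval-bottom ix (ascending⇒interval ns (index-next _ _ n ix))

  -- The last box has the lowest content, and its index is a positive number because its row is at
  -- most `N`.
  descending⇒interval : ∀ {x xs} → Linked (flip Next) (x ∷ xs) → All (λ z → row z ≤ N) (x ∷ xs) →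
                        ∃ λ s → Index (s + suc (length xs)) x × Interval (x ∷ xs) s (suc (length xs))
  descending⇒interval {a , b} [-] (a≤N ∷ []) = s , ix , interval-top ix (interval-[] s)
    where
    s = b + N ∸ a
    ix : Index (s + 1) (a , b)
    ix = trans (cong suc (sym (m∸n+n≡m (≤-trans a≤N (m≤n+m N b))))) (cong (_+ a) (+-comm 1 s))
  descending⇒interval {x} {y ∷ _} (n ∷ ns) (_ ∷ all) with descending⇒interval ns all
  ... | s , ix , iv = s , ix′ , interval-top ix′ iv
    where ix′ = subst (λ t → Index t x) (sym (+-suc s _)) (index-next y x n ix)

  monotone⇒interval : ∀ {xs} → Linked Next xs ⊎ Linked (flip Next) xs → All (λ z → row z ≤ N) xs →
                      ∃ λ s → Interval xs s (length xs)
  monotone⇒interval {[]} _ _ = 0 , interval-[] 0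
  monotone⇒interval {x ∷ xs} (inj₂ ns) all with descending⇒interval ns all
  ... | s , _ , iv = s , iv
  monotone⇒interval {(a , b) ∷ xs} (inj₁ ns) (a≤N ∷ _) =
    b + N ∸ a , ascending⇒interval ns (cong suc (sym (m∸n+n≡m (≤-trans a≤N (m≤n+m N b)))))

  -- Each diagonal in the interval loses exactly one box, which lowers the count there by one; the
  -- other diagonals are untouched.
  interval⇒moved : ∀ p q {xs s n} → 0 < n → q ≐ p ∖ xs → All (_∈ᵈ p) xs →
    (∀ {x y} → x ∈ xs → y ∈ xs → x ≈ᶜ y → x ≡ y) → Interval xs s n → Moved (rank p) (rank q) s (s + n)
  interval⇒moved p q {s = s} 0<n q≐ inside inj iv = record
    { g<x     = m<m+n s 0<n
    ; between = λ l l′ → let z , z∈ , ix = covers iv l l′ in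
        rank-removed p q q≐ z∈ (All.lookup inside z∈) ix λ z′∈ ix′ → inj z′∈ z∈ (index⇒≈ᶜ ix′ ix)
    ; below   = λ l → rank-unchanged p q q≐ λ z∈ ix → let t , l′ , _ , ix′ = within iv z∈ in
        <⇒≱ l′ (≤-trans (≤-reflexive (index-functional ix′ ix)) l)
    ; above   = λ l → rank-unchanged p q q≐ λ z∈ ix → let t , _ , l′ , ix′ = within iv z∈ in
        <⇒≱ l (≤-trans (≤-reflexive (index-functional ix ix′)) l′)
    }

  -- This reads the row of a hook box off from the count at its index, so the hook is horizontal
  -- exactly when the count is constant on its indices.
  interval-row : ∀ p q {xs s n} → q ≐ p ∖ xs → All (_∈ᵈ p) xs →
    (∀ {x y} → x ∈ xs → y ∈ xs → x ≈ᶜ y → x ≡ y) → Interval xs s n →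
    ∀ {z t} → z ∈ xs → Index t z → suc (row z) ≡ rank p t
  interval-row p q {xs = xs} q≐ inside inj iv {z} {t} z∈ ix =
      trans (cong suc (rank-row p q q≐ z∈ (All.lookup inside z∈) ix only))
            (sym (rank-removed p q q≐ z∈ (All.lookup inside z∈) ix only))
    where
    only : ∀ {z′} → z′ ∈ xs → Index t z′ → z′ ≡ z
    only z′∈ ix′ = inj z′∈ z∈ (index⇒≈ᶜ ix′ ix)

  module _ (ℓ : ℕ) .{{_ : NonZero ℓ}} (2≤ℓ : 2 ≤ ℓ) where
    open Residues ℓ 2≤ℓ

    module _ {p} (bounded : part p N ≡ 0) (h : RimHook ℓ p) where
      open RimHook h

      private
        row≤N : ∀ {z} → z ∈ᵈ p → row z ≤ N
        row≤N {a , b} z∈ = ≮⇒≥ λ l → n≮0 (≤-trans z∈ (≤-trans (part-antitone p (<⇒≤ l)) (≤-reflexive bounded)))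

      hook-interval : ∃ λ s → Interval boxes s ℓ
      hook-interval = subst (λ n → ∃ λ s → Interval boxes s n) size
        (monotone⇒interval (monotone-path connected distinct (hook-content-injective h)) (All.map row≤N inside))

      hook-moved : Moved (rank p) (rank remainder) (proj₁ hook-interval) (proj₁ hook-interval + ℓ)
      hook-moved = interval⇒moved p remainder (≤-trans (n≤1+n 1) 2≤ℓ) removes inside (hook-content-injective h) (proj₂ hook-interval)

      hook-carter : Carter (rank p) → Carter (rank remainder)
      hook-carter = carter-moved (rank-staircase p) (rank-staircase remainder) hook-moved

      hook-horizontal : Carter (rank p) → Horizontal h
      hook-horizontal carter = pred (rank p (proj₁ hook-interval + ℓ)) , All.tabulate λ z∈ →
        let t , l , l′ , ix = within (proj₂ hook-interval) z∈ in
        cong pred (trans (interval-row p remainder removes inside (hook-content-injective h) (proj₂ hook-interval) z∈ ix)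
                         (carter-flat (rank-staircase p) (rank-staircase remainder) hook-moved carter l l′))

    carter⇒noNonHorizontal : ∀ {p q} → part p N ≡ 0 → Carter (rank p) → Star (RemoveHorizontal ℓ) p q →
                             ¬ HasNonHorizontal ℓ q
    carter⇒noNonHorizontal bounded carter ε (h , ¬hor) = ¬hor (hook-horizontal bounded h carter)
    carter⇒noNonHorizontal {p} bounded carter ((h , _ , refl) ◅ path) = carter⇒noNonHorizontal
      (n≤0⇒n≡0 (≤-trans (∖⇒part-≤ p (RimHook.remainder h) (RimHook.removes h) N) (≤-reflexive bounded)))
      (hook-carter bounded h carter) path

-- Construction of rim hooks

allPairs-compare : ∀ {A : Set} {R : A → A → Set} {xs x y} → AllPairs R xs → x ∈ xs → y ∈ xs → x ≡ y ⊎ R x y ⊎ R y x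
allPairs-compare _          (here refl) (here refl) = inj₁ refl
allPairs-compare (rs ∷ _)   (here refl) (there y∈)  = inj₂ (inj₁ (All.lookup rs y∈))
allPairs-compare (rs ∷ _)   (there x∈)  (here refl) = inj₂ (inj₂ (All.lookup rs x∈))
allPairs-compare (_ ∷ rest) (there x∈)  (there y∈)  = allPairs-compare rest x∈ y∈

infix 4 _⊏_

-- Comparison of contents `b - a`.
_⊏_ : Box → Box → Set
(a , b) ⊏ (a′ , b′) = b + a′ < b′ + a

⊏-trans : ∀ {x y z} → x ⊏ y → y ⊏ z → x ⊏ z
⊏-trans {a , b} {a′ , b′} {a″ , b″} l l′ = +-cancelʳ-< (b′ + a′) _ _
  (subst₂ _<_ (eq b a′ b′ a″) (eq′ b′ a b″ a′) (+-mono-< l l′))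
  where
  eq : ∀ b a b′ a″ → b + a + (b′ + a″) ≡ b + a″ + (b′ + a)
  eq = solve-∀
  eq′ : ∀ b a b′ a″ → b + a + (b′ + a″) ≡ b′ + a + (b + a″)
  eq′ = solve-∀

next⇒⊏ : ∀ {x y} → Next x y → x ⊏ y
next⇒⊏ right      = ≤-refl
next⇒⊏ (up {a} {b}) = ≤-reflexive (sym (+-suc b a))

ascending-⊏ : ∀ {xs} → Linked Next xs → AllPairs _⊏_ xs
ascending-⊏ ns = Linked⇒AllPairs (λ {x} {y} {z} → ⊏-trans {x} {y} {z}) (Linked.map next⇒⊏ ns)

ascending-content-injective : ∀ {xs x y} → Linked Next xs → x ∈ xs → y ∈ xs → x ≈ᶜ y → x ≡ y
ascending-content-injective ns x∈ y∈ e with allPairs-compare (ascending-⊏ ns) x∈ y∈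
... | inj₁ x≡y        = x≡y
... | inj₂ (inj₁ l) = ⊥-elim (<-irrefl e l)
... | inj₂ (inj₂ l) = ⊥-elim (<-irrefl (sym e) l)

∖-∷ : ∀ p p′ q {x xs} → p′ ≐ p ∖ [ x ] → q ≐ p′ ∖ xs → q ≐ p ∖ (x ∷ xs)
∖-∷ p p′ q p′≐ q≐ z = mk⇔
  (λ h → let h′ , z∉ = to (q≐ z) h ; h″ , z≢ = to (p′≐ z) h′ in
     h″ , λ { (here refl) → z≢ (here refl) ; (there z∈) → z∉ z∈ })
  (λ (h , z∉) → from (q≐ z) (from (p′≐ z) (h , λ { (here refl) → z∉ (here refl) }) , z∉ ∘ there))

∖-∷ʳ : ∀ p p′ q {x xs} → p′ ≐ p ∖ xs → q ≐ p′ ∖ [ x ] → q ≐ p ∖ (x ∷ xs)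
∖-∷ʳ p p′ q p′≐ q≐ z = mk⇔
  (λ h → let h′ , z≢ = to (q≐ z) h ; h″ , z∉ = to (p′≐ z) h′ in
     h″ , λ { (here refl) → z≢ (here refl) ; (there z∈) → z∉ z∈ })
  (λ (h , z∉) → from (q≐ z) (from (p′≐ z) (h , z∉ ∘ there) , λ { (here refl) → z∉ (here refl) }))

module _ (N : ℕ) where
  open Abacus N
  open Interval

  next-right : ∀ {t x y} → Index t x → Index (suc t) y → row x ≡ row y → Next x y
  next-right {t} {a , b} {_ , b′} ix iy refl
    with refl ← +-cancelʳ-≡ N b′ (suc b) (suc-injective (trans iy (cong suc (sym ix)))) = right

  next-up : ∀ {t x y} → Index t x → Index (suc t) y → row x ≡ suc (row y) → Next x y
  next-up {t} {_ , b} {a , b′} ix iy refl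
    with refl ← +-cancelʳ-≡ N b′ b (suc-injective (trans iy (sym (trans ix (+-suc t a))))) = up

  -- A rim hook of `n + 1` boxes by increasing content, whose removal takes a bead from `s + suc n`
  -- to `s`. Index and row of its first box are kept so that one more box can be attached there.
  record Strip (p : Partition) (s n : ℕ) : Set where
    field
      first     : Box
      rest      : List Box
      remainder : Partition
      removes   : remainder ≐ p ∖ (first ∷ rest)
      size      : length rest ≡ n
      ascending : Linked Next (first ∷ rest)
      inside    : All (_∈ᵈ p) (first ∷ rest)
      index     : Index (suc s) first
      first-row : suc (row first) ≡ rank p (suc s)

    interval : Interval N (first ∷ rest) s (suc n)
    interval = subst (λ k → Interval N (first ∷ rest) s (suc k)) size (ascending⇒interval N ascending index)

    moved : Moved (rank p) (rank remainder) s (s + suc n)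
    moved = interval⇒moved N p remainder (s≤s z≤n) removes inside (ascending-content-injective ascending) interval

  rest≡[] : ∀ {p s} (st : Strip p s 0) → Strip.rest st ≡ []
  rest≡[] st with Strip.rest st | Strip.size st
  ... | [] | _ = refl

  private
    shift-bead : ∀ r {s n} → Bead r (s + suc (suc n)) → Bead r (suc s + suc n)
    shift-bead r {s} {n} = subst (Bead r) (+-suc s (suc n))

  corner-strip : ∀ p {s} → Gap (rank p) s → Bead (rank p) (suc s) → Strip p s 0
  corner-strip p gap bead with removable-corner p gap bead
  ... | b , ix , c with corner⇒removable p _ c
  ...   | ∈p , q , q≐ = record
    { first = _ , b ; rest = [] ; remainder = q ; removes = q≐ ; size = refl
    ; ascending = [-] ; inside = ∈p ∷ [] ; index = ix ; first-row = sym bead }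

  module _ p {s} (gap : Gap (rank p) s) (bead : Bead (rank p) (suc s)) (st : Strip p s 0) where
    open Strip st
    open Moved moved

    private
      s+1 : s + 1 ≡ suc s
      s+1 = +-comm s 1
      after : ∀ {t} → suc s < t → rank p t ≡ rank remainder t
      after l = above (≤-trans (≤-reflexive (cong suc s+1)) l)

    corner-gap : Gap (rank remainder) (suc s)
    corner-gap = suc-injective (trans (sym (between ≤-refl g<x)) (trans bead (cong suc (after ≤-refl))))

    corner-bead : ∀ {n} → Bead (rank p) (s + suc (suc n)) → Bead (rank remainder) (suc s + suc n)
    corner-bead {n} b = bead-cong (rank p) (rank remainder) _ (after l) (after (m<n⇒m<1+n l)) (shift-bead (rank p) b)
      where
      l : suc s < suc s + suc n
      l = m<m+n (suc s) (s≤s z≤n)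

    -- The bead at `s + 1` makes the count drop between the first two diagonals, so the hook turns
    -- up after its first box.
    prepend-corner : ∀ {n} → Strip remainder (suc s) n → Strip p s (suc n)
    prepend-corner st′ = record
      { first = first ; rest = Strip.first st′ ∷ Strip.rest st′ ; remainder = Strip.remainder st′
      ; removes = ∖-∷ p remainder (Strip.remainder st′)
          (subst (λ xs → remainder ≐ p ∖ (first ∷ xs)) (rest≡[] st) removes) (Strip.removes st′)
      ; size = cong suc (Strip.size st′)
      ; ascending = next-up index (Strip.index st′)
          (suc-injective (trans first-row (trans bead (cong suc (trans (after ≤-refl) (sym (Strip.first-row st′)))))))
          ∷ Strip.ascending st′
      ; inside = All.head inside ∷ All.map (λ h → proj₁ (to (removes _) h)) (Strip.inside st′)
      ; index = index ; first-row = first-row }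

  module _ p {s n} (gap : Gap (rank p) s) (gap′ : Gap (rank p) (suc s)) (st : Strip p (suc s) n) where
    open Strip st
    open Moved moved

    private
      drop : rank p (suc (suc s)) ≡ suc (rank remainder (suc (suc s)))
      drop = between ≤-refl g<x

      gap-s : Gap (rank remainder) s
      gap-s = gap-cong (rank p) (rank remainder) s (below (n≤1+n s)) (below ≤-refl) gap
      bead-s : Bead (rank remainder) (suc s)
      bead-s = trans (sym (below ≤-refl)) (trans gap′ drop)

    -- With a gap at `s + 1` the count is equal on the first two diagonals, so the hook runs to the
    -- right from its first box. That box is removed last.
    append-corner : Strip p s (suc n)
    append-corner = record
      { first = x ; rest = first ∷ rest ; remainder = Strip.remainder corner
      ; removes = ∖-∷ʳ p remainder (Strip.remainder corner) removes
          (subst (λ xs → Strip.remainder corner ≐ remainder ∖ (x ∷ xs)) (rest≡[] corner) (Strip.removes corner))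
      ; size = cong suc size
      ; ascending = next-right (Strip.index corner) index
          (suc-injective (trans (Strip.first-row corner) (trans bead-s (trans (sym drop) (sym first-row))))) ∷ ascending
      ; inside = proj₁ (to (removes _) (All.head (Strip.inside corner))) ∷ inside
      ; index = Strip.index corner
      ; first-row = trans (Strip.first-row corner) (sym (below ≤-refl)) }
      where
      corner : Strip remainder s 0
      corner = corner-strip remainder gap-s bead-s
      x : Box
      x = Strip.first corner

  -- The bead at s + n + 1 travels down to the gap s in unit steps, each of which removes a corner: if s + 1 is
  -- occupied, that bead makes room first, otherwise it is filled first.
  abstract
    strip : ∀ n p {s} → Gap (rank p) s → Bead (rank p) (s + suc n) → Strip p s n
    strip zero p {s} gap bead = corner-strip p gap (subst (Bead (rank p)) (+-comm s 1) bead)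
    strip (suc n) p {s} gap bead with rank-staircase p (suc s)
    ... | inj₁ bead′ = prepend-corner p gap bead′ c (strip n _ (corner-gap p gap bead′ c) (corner-bead p gap bead′ c bead))
      where
        c : Strip p s 0
        c = corner-strip p gap bead′
    ... | inj₂ gap′  = append-corner p gap gap′ (strip n p gap′ (shift-bead (rank p) bead))

  strip⇒hook : ∀ {p s n} → Strip p s n → RimHook (suc n) p
  strip⇒hook st = record
    { boxes     = first ∷ rest
    ; size      = cong suc size
    ; distinct  = AllPairs.map (λ { l refl → <-irrefl refl l }) (ascending-⊏ ascending)
    ; inside    = inside
    ; connected = Linked.map next⇒adjacent ascending
    -- The upper left and lower right boxes of a square have equal content.
    ; noSquare  = λ (a , b , x∈ , _ , _ , y∈) →
        1+n≢n (sym (cong proj₁ (ascending-content-injective ascending x∈ y∈ (+-suc b a))))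
    ; remainder = remainder
    ; removes   = removes
    }
    where open Strip st

  module _ {p s n} (st : Strip p s n) where
    open Strip st

    strip-row : ∀ {z t} → z ∈ first ∷ rest → Index t z → suc (row z) ≡ rank p t
    strip-row = interval-row N p remainder removes inside (ascending-content-injective ascending) interval

    strip-horizontal : rank p (suc s) ≡ rank p (s + suc n) → Horizontal (strip⇒hook st)
    strip-horizontal flat = pred (rank p (suc s)) , All.tabulate λ z∈ →
      let t , l , l′ , ix = within interval z∈ in
      cong pred (trans (strip-row z∈ ix) (≤-antisym (rank-antitone p l) (≤-trans (≤-reflexive flat) (rank-antitone p l′))))

    strip-nonhorizontal : rank p (suc s) ≢ rank p (s + suc n) → ¬ Horizontal (strip⇒hook st)
    strip-nonhorizontal step (a , rows) =
      let z , z∈ , ix = covers interval ≤-refl (m<m+n s (s≤s z≤n))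
          w , w∈ , iw = covers interval (m<m+n s (s≤s z≤n)) ≤-refl in
      step (trans (sym (strip-row z∈ ix)) (trans (cong suc (trans (All.lookup rows z∈) (sym (All.lookup rows w∈))))
        (strip-row w∈ iw)))

  -- Necessity of the condition on gaps

  NoNonHorizontal : ℕ → Partition → Set
  NoNonHorizontal ℓ p = ∀ {q} → Star (RemoveHorizontal ℓ) p q → ¬ HasNonHorizontal ℓ q

  module _ (ℓ-1 : ℕ) (2≤ℓ : 2 ≤ suc ℓ-1) where
    private ℓ = suc ℓ-1
    open Residues ℓ 2≤ℓ

    -- If `z` is vacant, some hook takes the bead `z + ℓ` to `z`. It must be horizontal, so its
    -- remainder inherits the hypothesis, and the only bead lost has the residue of `z`.
    lower-bead : ∀ p {g z} → NoNonHorizontal ℓ p → g < z → Gap (rank p) g → Bead (rank p) (z + ℓ) →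
      ∃ λ q → NoNonHorizontal ℓ q × Gap (rank q) g × Bead (rank q) z ×
              (∀ {w} → Bead (rank p) w → ¬ (w ≋ z) → Bead (rank q) w)
    lower-bead p {g} {z} nn g<z gap bead with rank-staircase p z
    ... | inj₁ b = p , nn , gap , b , λ b _ → b
    ... | inj₂ h = slide (strip ℓ-1 p h bead)
      where
      slide : Strip p z ℓ-1 → ∃ λ q → NoNonHorizontal ℓ q × Gap (rank q) g × Bead (rank q) z ×
              (∀ {w} → Bead (rank p) w → ¬ (w ≋ z) → Bead (rank q) w)
      slide st with rank p (suc z) ≟ rank p (z + ℓ)
      ... | no step = ⊥-elim (nn ε (strip⇒hook st , strip-nonhorizontal st step))
      ... | yes flat = remainder , nn′
          , gap-cong (rank p) (rank remainder) g (below (<⇒≤ g<z)) (below g<z) gap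
          , moved-new (rank-staircase p) (rank-staircase remainder) moved
          , λ b w≢z → moved-bead⁺ (rank-staircase p) (rank-staircase remainder) moved b
                        λ { refl → w≢z ([m+n]%n≡m%n z ℓ) }
        where
        open Strip st
        open Moved moved
        nn′ : NoNonHorizontal ℓ remainder
        nn′ {q} path = nn {q} ((strip⇒hook st , strip-horizontal st flat , refl) ◅ path)

    private
      split : ∀ {g y} → g + ℓ < y → ∃ λ z → y ≡ z + ℓ × g < z
      split {g} {y} l = y ∸ ℓ , sym (m∸n+n≡m (≤-trans (m≤n+m ℓ g) (<⇒≤ l)))
                      , m+n≤o⇒m≤o∸n (suc g) l

      shrink : ∀ {z k} c → c + (z + ℓ) < suc k → c + z < k
      shrink {z} c l = ≤-trans (+-monoʳ-< c (m<m+n z (s≤s z≤n))) (s≤s⁻¹ l)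

    -- Lowering y, and then x, by ℓ keeps the configuration and stays among the horizontal removals; it ends
    -- with g < y < x = g + ℓ, a non-horizontal hook.
    no-obstruction : ∀ k p {g x y} → x + y < k → NoNonHorizontal ℓ p → g < x → g < y → Gap (rank p) g →
                     Bead (rank p) x → Bead (rank p) y → x ≋ g → ¬ (y ≋ g) → ⊥
    no-obstruction (suc k) p {g} {x} {y} fuel nn g<x g<y gap bx by x≋g y≢g with g + ℓ <? y | g + ℓ <? x
    ... | yes l | _ with split l
    ...   | z , refl , g<z with lower-bead p nn g<z gap by
    ...     | q , nn′ , gap′ , bz , keep = no-obstruction k q (shrink x fuel) nn′ g<x g<z gap′
              (keep bx λ e → y≢g (trans ([m+n]%n≡m%n z ℓ) (trans (sym e) x≋g))) bz x≋g
              (λ e → y≢g (trans ([m+n]%n≡m%n z ℓ) e))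
    no-obstruction (suc k) p {g} {x} {y} fuel nn g<x g<y gap bx by x≋g y≢g | no _ | yes l with split l
    ...   | z , refl , g<z with lower-bead p nn g<z gap bx
    ...     | q , nn′ , gap′ , bz , keep = no-obstruction k q
              (subst (_< k) (+-comm y z) (shrink y (subst (_< suc k) (+-comm x y) fuel))) nn′ g<z g<y gap′
              bz (keep by λ e → y≢g (trans e (trans (sym ([m+n]%n≡m%n z ℓ)) x≋g)))
              (trans (sym ([m+n]%n≡m%n z ℓ)) x≋g) y≢g
    no-obstruction (suc k) p {g} {x} {y} fuel nn g<x g<y gap bx by x≋g y≢g | no y≤ | no x≤
      with refl ← ≤-antisym (≋⇒apart g<x x≋g) (≮⇒≥ x≤) =
        nn ε (strip⇒hook st , strip-nonhorizontal st λ e → <⇒≱ drop (≤-reflexive e))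
      where
      st = strip ℓ-1 p gap bx
      y<x : y < g + ℓ
      y<x = ≤∧≢⇒< (≮⇒≥ y≤) λ { refl → y≢g x≋g }
      -- The bead `y` lies strictly between `g` and `g + ℓ`, so the count drops along the hook.
      drop : rank p (g + ℓ) < rank p (suc g)
      drop = ≤-trans (s≤s (rank-antitone p y<x)) (≤-trans (≤-reflexive (sym by)) (rank-antitone p g<y))

    noNonHorizontal⇒carter : ∀ p → NoNonHorizontal ℓ p → Carter (rank p)
    noNonHorizontal⇒carter p nn {g} {x} {y} g<x g<y gap bx by x≋g with y % ℓ ≟ g % ℓ
    ... | yes e = e
    ... | no n  = ⊥-elim (no-obstruction (suc (x + y)) p ≤-refl nn g<x g<y gap bx by x≋g n)

-- Regularity from the condition on gaps

-- A copy of `k` cannot follow a smaller entry, so under the bound the copies of `k` come first.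
run-from-bound : ∀ k xs → Linked _≥_ xs → entry xs 0 ≤ k → ∀ {j} → j < length (filter (_≟ k) xs) → entry xs j ≡ k
run-from-bound k (x ∷ xs) dec x≤k {j} l with x ≟ k
... | yes refl = first j (subst (λ ys → j < length ys) (filter-accept (_≟ k) refl) l)
  where
  first : ∀ j → j < suc (length (filter (_≟ k) xs)) → entry (k ∷ xs) j ≡ k
  first zero    _ = refl
  first (suc j) l = run-from-bound k xs (Linked.tail dec) (linked⇒entry (x ∷ xs) dec 0) (s≤s⁻¹ l)
... | no n = ⊥-elim (n (≤-antisym x≤k (≤-trans (≤-reflexive (sym at))
               (entry-antitone (x ∷ xs) (linked⇒entry _ dec) {0} {suc j} z≤n))))
  where
  at : entry xs j ≡ k
  at = run-from-bound k xs (Linked.tail dec) (≤-trans (linked⇒entry (x ∷ xs) dec 0) x≤k)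
         (subst (λ ys → j < length ys) (filter-reject (_≟ k) n) l)

run : ∀ k xs → Linked _≥_ xs → ∃ λ a → ∀ {j} → j < length (filter (_≟ k) xs) → entry xs (a + j) ≡ k
run k []       _   = 0 , λ ()
run k (x ∷ xs) dec with x ≤? k
... | yes x≤k = 0 , run-from-bound k (x ∷ xs) dec x≤k
... | no x≰k with run k xs (Linked.tail dec)
...   | a , e = suc a , λ {j} l → e (subst (λ ys → j < length ys) (filter-reject (_≟ k) {x} {xs} λ { refl → x≰k ≤-refl }) l)

module _ (ℓ : ℕ) .{{_ : NonZero ℓ}} (2≤ℓ : 2 ≤ ℓ) where
  open Residues ℓ 2≤ℓ

  -- A gap just below a run of ℓ beads would see the top bead of the run, which is congruent to it,
  -- and the bottom one, which is not. So the run slides down to 0 and every position below `z` is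
  -- occupied.
  carter⇒no-run : ∀ {r} → Staircase r → Carter r → ∀ z → (∀ {j} → j < ℓ → Bead r (z + j)) → r 0 ≡ z + r z
  carter⇒no-run st carter zero _ = refl
  carter⇒no-run {r} st carter (suc z) beads with st z
  ... | inj₂ gap = ⊥-elim (suc-≋̸ z (carter {z} {z + ℓ} {suc z} (m<m+n z 0<ℓ) ≤-refl gap
          (subst (Bead r) (trans (sym (+-suc z _)) (cong (z +_) (m+[n∸m]≡n 0<ℓ))) (beads {ℓ ∸ 1} (∸-monoʳ-< {ℓ} (s≤s z≤n) 0<ℓ)))
          (subst (Bead r) (+-identityʳ (suc z)) (beads {0} 0<ℓ)) ([m+n]%n≡m%n z ℓ)))
    where
    0<ℓ : 0 < ℓ
    0<ℓ = ≤-trans (n≤1+n 1) 2≤ℓ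
  ... | inj₁ bead = trans (carter⇒no-run {r} st carter z λ { {zero} _ → subst (Bead r) (sym (+-identityʳ z)) bead
                                              ; {suc j} l → subst (Bead r) (sym (+-suc z j)) (beads (<-trans ≤-refl l)) })
                          (trans (cong (z +_) bead) (+-suc z _))

  module _ (N : ℕ) where
    open Abacus N

    -- ℓ equal parts `k`, the last in row `m`, give ℓ consecutive beads starting at `z`. Every
    -- position below is then occupied, so the beads from 0 on number `z + m + 1 = k + N + 1`. But
    -- row `N` is empty and has its bead at 0, so they number `N + 1`.
    carter⇒regular : ∀ p → part p N ≡ 0 → Carter (rank p) → Regular ℓ p
    carter⇒regular p bounded carter k 0<k le with run k (parts p) (decreasing p)
    ... | a , rows = <-irrefl suc-N (s≤s (m<n+m N 0<k))
      where
      m = a + (ℓ ∸ 1)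
      ℓ≡ : suc (ℓ ∸ 1) ≡ ℓ
      ℓ≡ = m+[n∸m]≡n (≤-trans (n≤1+n 1) 2≤ℓ)
      -- The bead of row `m`; the subtraction is exact since `m < N`.
      z = k + N ∸ m
      m<N : m < N
      m<N = ≰⇒> λ N≤m → <⇒≱ 0<k (≤-trans (≤-reflexive (sym (rows (≤-trans (≤-reflexive ℓ≡) le))))
              (≤-trans (part-antitone p N≤m) (≤-reflexive bounded)))
      z+m : z + m ≡ k + N
      z+m = m∸n+n≡m (≤-trans (<⇒≤ m<N) (m≤n+m N k))
      row-bead : ∀ {j} → j < ℓ → part p (a + (ℓ ∸ 1 ∸ j)) + N ≡ z + j + (a + (ℓ ∸ 1 ∸ j))
      row-bead {j} l = trans (cong (_+ N) (rows (≤-trans (s≤s (m∸n≤m (ℓ ∸ 1) j)) (≤-trans (≤-reflexive ℓ≡) le))))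
        (trans (sym z+m) (trans (cong (λ i → z + (a + i)) (sym (m+[n∸m]≡n (s≤s⁻¹ (≤-trans l (≤-reflexive (sym ℓ≡)))))))
          (trans (cong (z +_) (trans (sym (+-assoc a j _)) (trans (cong (_+ (ℓ ∸ 1 ∸ j)) (+-comm a j)) (+-assoc j a _))))
                 (sym (+-assoc z j _)))))
      beads : ∀ {j} → j < ℓ → Bead (rank p) (z + j)
      beads l = part⇒bead p (row-bead l)
      suc-N : suc N ≡ suc (k + N)
      suc-N = trans (sym (proj₂ (part⇒rank p {0} {N} (cong (_+ N) bounded))))
        (trans (carter⇒no-run (rank-staircase p) carter z beads)
        (trans (cong (z +_) (proj₂ (part⇒rank p {z} {m}
                  (trans (cong (_+ N) (rows (≤-trans (≤-reflexive ℓ≡) le))) (sym z+m)))))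
        (trans (+-suc z m) (cong suc z+m))))

    carter⇒IsℓPartition : ∀ p → part p N ≡ 0 → Carter (rank p) → IsℓPartition ℓ p
    carter⇒IsℓPartition p bounded carter = record
      { regular = carter⇒regular p bounded carter
      ; noNonHorizontal = carter⇒noNonHorizontal N ℓ 2≤ℓ bounded carter }

  -- Residues of boxes and residues of positions

  ≡-mod⇒≋ : ∀ t s k → ℤ.+ t ≡ ℤ.+ s ℤ.+ k ℤ.* ℤ.+ ℓ → t ≋ s
  ≡-mod⇒≋ t s (ℤ.+ m) e = trans (cong (_% ℓ) (ℤ.+-injective (trans e (cong (λ n → ℤ.+ s ℤ.+ n) (sym (ℤ.pos-* m ℓ))))))
                                 ([m+kn]%n≡m%n s m ℓ)
  ≡-mod⇒≋ t s -[1+ m ] e = trans (sym ([m+kn]%n≡m%n t (suc m) ℓ)) (cong (_% ℓ) (ℤ.+-injective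
    (trans (cong (λ n → ℤ.+ t ℤ.+ n) (ℤ.pos-* (suc m) ℓ)) (trans (cong (λ n → n ℤ.+ ℤ.+ suc m ℤ.* ℤ.+ ℓ) e)
      (collapse (ℤ.+ s) (ℤ.+ suc m) (ℤ.+ ℓ))))))
    where
    collapse : ∀ s m l → s ℤ.+ ℤ.- m ℤ.* l ℤ.+ m ℤ.* l ≡ s
    collapse = ℤSolver.solve-∀

  module _ (K : ℕ) where
    open Abacus (K * ℓ)

    -- Here `t = 1 + (b - a) + K * ℓ`, and the shift vanishes modulo ℓ.
    index⇒≋ : ∀ {t x} → Index t x → t ≋ suc (residue ℓ x)
    index⇒≋ {t} {a , b} ix = ≡-mod⇒≋ t (suc r) (q ℤ.+ ℤ.+ K)
      (trans t≡ (trans (cong (λ d → ℤ.+ 1 ℤ.+ d ℤ.+ ℤ.+ K ℤ.* ℤ.+ ℓ) (a≡a%ℕn+[a/ℕn]*n (ℤ.+ b ℤ.- ℤ.+ a) ℓ))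
        (regroup (ℤ.+ r) q (ℤ.+ ℓ) (ℤ.+ K))))
      where
      r = residue ℓ (a , b)
      q = (ℤ.+ b ℤ.- ℤ.+ a) /ℕ ℓ
      regroup : ∀ r q l k → ℤ.+ 1 ℤ.+ (r ℤ.+ q ℤ.* l) ℤ.+ k ℤ.* l ≡ ℤ.+ 1 ℤ.+ r ℤ.+ (q ℤ.+ k) ℤ.* l
      regroup = ℤSolver.solve-∀
      subtract : ∀ t a → t ≡ t ℤ.+ a ℤ.- a
      subtract = ℤSolver.solve-∀
      rearrange : ∀ b n a → ℤ.+ 1 ℤ.+ (b ℤ.+ n) ℤ.- a ≡ ℤ.+ 1 ℤ.+ (b ℤ.- a) ℤ.+ n
      rearrange = ℤSolver.solve-∀
      t≡ : ℤ.+ t ≡ ℤ.+ 1 ℤ.+ (ℤ.+ b ℤ.- ℤ.+ a) ℤ.+ ℤ.+ K ℤ.* ℤ.+ ℓ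
      t≡ = trans (subtract (ℤ.+ t) (ℤ.+ a)) (trans (cong (λ n → n ℤ.- ℤ.+ a) (cong ℤ.+_ (sym ix)))
             (trans (rearrange (ℤ.+ b) (ℤ.+ (K * ℓ)) (ℤ.+ a))
                    (cong (λ n → ℤ.+ 1 ℤ.+ (ℤ.+ b ℤ.- ℤ.+ a) ℤ.+ n) (ℤ.pos-* K ℓ))))

    index⇒residue : ∀ {t x i} → i < ℓ → Index t x → t ≋ suc i → residue ℓ x ≡ i
    index⇒residue {t} {x@(a , b)} i<ℓ ix e = trans (sym (m<n⇒m%n≡m (n%ℕd<d (ℤ.+ b ℤ.- ℤ.+ a) ℓ)))
      (trans (suc-≋⁻ (trans (sym (index⇒≋ {t} {x} ix)) e)) (m<n⇒m%n≡m i<ℓ))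

-- Signatures

module _ {A B : Set} (f : A → Maybe B) where

  ∈-mapMaybe⁺ : ∀ {xs x y} → x ∈ xs → f x ≡ just y → y ∈ mapMaybe f xs
  ∈-mapMaybe⁺ {x ∷ _} (here refl) e with just _ ← f x | refl ← e = here refl
  ∈-mapMaybe⁺ {x ∷ _} (there x∈) e with f x
  ... | nothing = ∈-mapMaybe⁺ x∈ e
  ... | just _  = there (∈-mapMaybe⁺ x∈ e)

  ∈-mapMaybe⁻ : ∀ xs {y} → y ∈ mapMaybe f xs → ∃ λ x → x ∈ xs × f x ≡ just y
  ∈-mapMaybe⁻ (x ∷ xs) y∈ with f x in eq
  ∈-mapMaybe⁻ (x ∷ xs) y∈          | nothing = let z , z∈ , e = ∈-mapMaybe⁻ xs y∈ in z , there z∈ , e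
  ∈-mapMaybe⁻ (x ∷ xs) (here refl) | just _  = x , here refl , eq
  ∈-mapMaybe⁻ (x ∷ xs) (there y∈)  | just _  = let z , z∈ , e = ∈-mapMaybe⁻ xs y∈ in z , there z∈ , e

  allPairs-mapMaybe : ∀ {R : A → A → Set} {S : B → B → Set} →
    (∀ {x y s t} → R x y → f x ≡ just s → f y ≡ just t → S s t) → ∀ {xs} → AllPairs R xs → AllPairs S (mapMaybe f xs)
  allPairs-mapMaybe h [] = []
  allPairs-mapMaybe h {x ∷ xs} (rs ∷ rest) with f x in eq
  ... | nothing = allPairs-mapMaybe h rest
  ... | just s  = All.tabulate (λ t∈ → let y , y∈ , e = ∈-mapMaybe⁻ xs t∈ in h (All.lookup rs y∈) eq e)
                ∷ allPairs-mapMaybe h rest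

last-exists : ∀ {A : Set} {n} (xs : List A) → length xs ≡ suc n → ∃ λ x → last xs ≡ just x × x ∈ xs
last-exists (x ∷ [])     _ = x , refl , here refl
last-exists (_ ∷ y ∷ xs) _ = let z , e , z∈ = last-exists (y ∷ xs) refl in z , e , there z∈

last-greatest : ∀ {A : Set} {R : A → A → Set} {xs x z} → AllPairs R xs → last xs ≡ just x → z ∈ xs → z ≡ x ⊎ R z x
last-greatest {xs = _ ∷ []}    _           refl (here e)    = inj₁ e
last-greatest {xs = _ ∷ _ ∷ _} (rs ∷ _)    e    (here refl) =
  let _ , e′ , x∈ = last-exists _ refl in
  inj₂ (All.lookup rs (subst (_∈ _) (just-injective (trans (sym e′) e)) x∈))
last-greatest {xs = _ ∷ _ ∷ _} (_ ∷ rest)  e    (there z∈)  = last-greatest rest e z∈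

-- `xs` and `x ∷ ys` are duplicate-free with the same elements, hence permutations of each other.
unique-length : ∀ {A : Set} {x : A} {xs ys} → Unique xs → Unique ys → x ∈ xs → x ∉ ys →
  (∀ {z} → z ∈ xs → z ≢ x → z ∈ ys) → (∀ {z} → z ∈ ys → z ∈ xs) → (∀ z → Dec (z ≡ x)) → length xs ≡ suc (length ys)
unique-length {x = x} {xs} {ys} u v x∈ x∉ sub sup _≟x = ↭-length (∼bag⇒↭ (unique∧set⇒bag u
    (All.tabulate (λ { y∈ refl → x∉ y∈ }) ∷ v) (mk⇔ forth λ { (here refl) → x∈ ; (there z∈) → sup z∈ })))
  where
  forth : ∀ {z} → z ∈ xs → z ∈ x ∷ ys
  forth {z} z∈ with z ≟x
  ... | yes refl = here refl
  ... | no n     = there (sub z∈ n)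

infix 4 _◁_

-- The order in which the signature is read.
_◁_ : Box → Box → Set
(a , b) ◁ (a′ , b′) = a′ < a ⊎ (a ≡ a′ × b < b′)

◁-irrefl : ∀ {x} → ¬ (x ◁ x)
◁-irrefl (inj₁ l)       = <-irrefl refl l
◁-irrefl (inj₂ (_ , l)) = <-irrefl refl l

positions-sorted : ∀ p → AllPairs _◁_ (positions p)
positions-sorted p = go (downFrom (suc (length (parts p)))) (AllPairs.applyDownFrom⁺₁ id _ λ l _ → l)
  where
  columns = upTo (suc (part p 0))
  in-row : ∀ a → AllPairs _◁_ (map (a ,_) columns)
  in-row a = AllPairs.map⁺ (AllPairs.applyUpTo⁺₁ id _ λ l _ → inj₂ (refl , l))
  go : ∀ as → AllPairs (λ a a′ → a′ < a) as → AllPairs _◁_ (cartesianProduct as columns)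
  go [] _ = []
  go (a ∷ as) (rs ∷ rest) = AllPairs.++⁺ (in-row a) (go as rest) (All.tabulate λ x∈ → All.tabulate λ y∈ → cross x∈ y∈)
    where
    cross : ∀ {x y} → x ∈ map (a ,_) columns → y ∈ cartesianProduct as columns → x ◁ y
    cross x∈ y∈ with _ , _ , refl ← ∈-map⁻ (a ,_) x∈ = inj₁ (All.lookup rs (proj₁ (∈-cartesianProduct⁻ as columns y∈)))

∈-positions : ∀ p {a b} → a ≤ length (parts p) → b ≤ part p 0 → (a , b) ∈ positions p
∈-positions p a≤ b≤ = ∈-cartesianProduct⁺ (∈-downFrom⁺ (s≤s a≤)) (∈-upTo⁺ (s≤s b≤))

module _ {p : Partition} where

  box : Signed p → Box
  box (minus x _) = x
  box (plus y _)  = y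

  NoClash : Signed p → Signed p → Set
  NoClash (minus _ _) (plus _ _) = ⊥
  NoClash _           _          = ⊤

  reduce-sorted : ∀ {w} → AllPairs NoClash w → reduce w ≡ w
  reduce-sorted [] = refl
  reduce-sorted {s ∷ w} (ns ∷ rest) rewrite reduce-sorted rest = cancel-sorted s ns
    where
    cancel-sorted : ∀ s {w} → All (NoClash s) w → cancel s w ≡ s ∷ w
    cancel-sorted (plus _ _)  _               = refl
    cancel-sorted (minus _ _) []              = refl
    cancel-sorted (minus _ _) {minus _ _ ∷ _} _ = refl
    cancel-sorted (minus _ _) {plus _ _ ∷ _} (() ∷ _)

  ∈-conormal⁺ : ∀ {w : List (Signed p)} {y s} → plus y s ∈ w → (y , s) ∈ conormal w
  ∈-conormal⁺ {plus _ _ ∷ _}  (here refl) = here refl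
  ∈-conormal⁺ {plus _ _ ∷ _}  (there h)   = there (∈-conormal⁺ h)
  ∈-conormal⁺ {minus _ _ ∷ _} (there h)   = ∈-conormal⁺ h

  ∈-conormal⁻ : ∀ (w : List (Signed p)) {y s} → (y , s) ∈ conormal w → plus y s ∈ w
  ∈-conormal⁻ (plus _ _ ∷ _)  (here refl) = here refl
  ∈-conormal⁻ (plus _ _ ∷ w)  (there h)   = there (∈-conormal⁻ w h)
  ∈-conormal⁻ (minus _ _ ∷ w) h           = there (∈-conormal⁻ w h)

  ∈-normal⁺ : ∀ {w : List (Signed p)} {y s} → minus y s ∈ w → (y , s) ∈ normal w
  ∈-normal⁺ {minus _ _ ∷ _} (here refl) = here refl
  ∈-normal⁺ {minus _ _ ∷ _} (there h)   = there (∈-normal⁺ h)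
  ∈-normal⁺ {plus _ _ ∷ _}  (there h)   = ∈-normal⁺ h

  ∈-normal⁻ : ∀ (w : List (Signed p)) {y s} → (y , s) ∈ normal w → minus y s ∈ w
  ∈-normal⁻ (minus _ _ ∷ _) (here refl) = here refl
  ∈-normal⁻ (minus _ _ ∷ w) (there h)   = there (∈-normal⁻ w h)
  ∈-normal⁻ (plus _ _ ∷ w)  h           = there (∈-normal⁻ w h)

  conormal-sorted : ∀ {w} → AllPairs (λ s t → box s ◁ box t) w → AllPairs (λ s t → proj₁ s ◁ proj₁ t) (conormal w)
  conormal-sorted [] = []
  conormal-sorted {plus _ _ ∷ w}  (rs ∷ rest) = All.tabulate (λ h → All.lookup rs (∈-conormal⁻ w h)) ∷ conormal-sorted rest
  conormal-sorted {minus _ _ ∷ w} (rs ∷ rest) = conormal-sorted rest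

  normal-sorted : ∀ {w} → AllPairs (λ s t → box s ◁ box t) w → AllPairs (λ s t → proj₁ s ◁ proj₁ t) (normal w)
  normal-sorted [] = []
  normal-sorted {minus _ _ ∷ w} (rs ∷ rest) = All.tabulate (λ h → All.lookup rs (∈-normal⁻ w h)) ∷ normal-sorted rest
  normal-sorted {plus _ _ ∷ w}  (rs ∷ rest) = normal-sorted rest

-- Each entry carries a proof about its own partition, so the lists of two partitions can be
-- compared only through their boxes.
sorted⇒unique : ∀ {P : Box → Set} {xs : List (∃ P)} → AllPairs (λ s t → proj₁ s ◁ proj₁ t) xs → Unique (map proj₁ xs)
sorted⇒unique ps = AllPairs.map⁺ (AllPairs.map (λ { l refl → ◁-irrefl l }) ps)

module _ (ℓ : ℕ) .{{_ : NonZero ℓ}} (i : ℕ) (p : Partition) where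

  sign-spec : ∀ {x s} → sign ℓ i p x ≡ just s → box s ≡ x × residue ℓ x ≡ i
  sign-spec {x} e with residue ℓ x ≟ i | removable? p x | addable? p x
  sign-spec refl | yes r | yes _ | _     = refl , r
  sign-spec refl | yes r | no _  | yes _ = refl , r

  sign-addable : ∀ {x} → residue ℓ x ≡ i → Addable p x → ∃ λ s → sign ℓ i p x ≡ just (plus x s)
  sign-addable {x} r ad with residue ℓ x ≟ i | removable? p x | addable? p x
  ... | no n  | _       | _     = ⊥-elim (n r)
  ... | yes _ | yes (∈p , _) | _ = ⊥-elim (proj₁ ad ∈p)
  ... | yes _ | no _    | yes s = s , refl
  ... | yes _ | no _    | no n  = ⊥-elim (n ad)

  sign-removable : ∀ {x} → residue ℓ x ≡ i → Removable p x → ∃ λ s → sign ℓ i p x ≡ just (minus x s)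
  sign-removable {x} r re with residue ℓ x ≟ i | removable? p x | addable? p x
  ... | no n  | _       | _     = ⊥-elim (n r)
  ... | yes _ | yes s   | _     = s , refl
  ... | yes _ | no n    | _     = ⊥-elim (n re)

  signature-sorted : AllPairs (λ s t → box s ◁ box t) (signature ℓ i p)
  signature-sorted = allPairs-mapMaybe (sign ℓ i p)
    (λ l e e′ → subst₂ _◁_ (sym (proj₁ (sign-spec e))) (sym (proj₁ (sign-spec e′))) l) (positions-sorted p)

  signature-residue : ∀ {s} → s ∈ signature ℓ i p → residue ℓ (box s) ≡ i
  signature-residue s∈ = let _ , _ , e = ∈-mapMaybe⁻ (sign ℓ i p) (positions p) s∈
                             e′ , r    = sign-spec e
                         in trans (cong (residue ℓ) e′) r

  addable-position : ∀ {y} → Addable p y → y ∈ positions p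
  addable-position {a , b} ad with addable⇒corner p (a , b) ad
  ... | e , above = ∈-positions p (rows a above) (≤-trans (≤-reflexive (sym e)) (part-antitone p z≤n))
    where
    rows : ∀ a → (∀ c → a ≡ suc c → b < part p c) → a ≤ length (parts p)
    rows zero    _ = z≤n
    rows (suc c) h = ≰⇒> λ l → n≮0 (≤-trans (h c refl) (≤-reflexive (entry-beyond (parts p) c l)))

  removable-position : ∀ {x} → Removable p x → x ∈ positions p
  removable-position {a , b} (∈p , _) = ∈-positions p
    (<⇒≤ (≰⇒> λ l → n≮0 (≤-trans ∈p (≤-reflexive (entry-beyond (parts p) a l)))))
    (≤-trans (<⇒≤ ∈p) (part-antitone p z≤n))

  addable∈signature : ∀ {y} → residue ℓ y ≡ i → Addable p y → ∃ λ s → (y , s) ∈ conormal (signature ℓ i p)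
  addable∈signature r ad = let s , e = sign-addable r ad in
    s , ∈-conormal⁺ {p} (∈-mapMaybe⁺ (sign ℓ i p) (addable-position ad) e)

  removable∈signature : ∀ {x} → residue ℓ x ≡ i → Removable p x → ∃ λ s → (x , s) ∈ normal (signature ℓ i p)
  removable∈signature r re = let s , e = sign-removable r re in
    s , ∈-normal⁺ {p} (∈-mapMaybe⁺ (sign ℓ i p) (removable-position re) e)

-- Crystal operators on the abacus

-- `r c - r (c + 2)` is the number of beads at `c` and `c + 1`. This and the next three lemmas read
-- the occupancy of a pair off from that number, which `Agree` preserves.
two-beads : ∀ {r} → Staircase r → ∀ c → r c ≡ suc (suc (r (suc (suc c)))) → Bead r c × Bead r (suc c)
two-beads {r} st c e with st c | st (suc c)
... | inj₁ b | inj₁ b′ = b , b′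
... | inj₁ b | inj₂ g  = ⊥-elim (1+n≢n (sym (suc-injective (trans (sym (trans b (cong suc g))) e))))
... | inj₂ g | inj₁ b  = ⊥-elim (1+n≢n (sym (suc-injective (trans (sym (trans g b)) e))))
... | inj₂ g | inj₂ g′ = ⊥-elim (<-irrefl (trans (sym (trans g g′)) e) (m<n⇒m<1+n ≤-refl))

two-gaps : ∀ {r} → Staircase r → ∀ c → r c ≡ r (suc (suc c)) → Gap r c × Gap r (suc c)
two-gaps {r} st c e with st c | st (suc c)
... | inj₂ g | inj₂ g′ = g , g′
... | inj₁ b | inj₂ g  = ⊥-elim (1+n≢n (trans (sym (trans b (cong suc g))) e))
... | inj₂ g | inj₁ b  = ⊥-elim (1+n≢n (trans (sym (trans g b)) e))
... | inj₁ b | inj₁ b′ = ⊥-elim (<-irrefl (trans (sym e) (trans b (cong suc b′))) (m<n⇒m<1+n ≤-refl))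

some-bead : ∀ {r} → Staircase r → ∀ c → r c ≢ r (suc (suc c)) → Bead r c ⊎ Bead r (suc c)
some-bead st c n with st c | st (suc c)
... | inj₁ b | _       = inj₁ b
... | _      | inj₁ b  = inj₂ b
... | inj₂ g | inj₂ g′ = ⊥-elim (n (trans g g′))

some-gap : ∀ {r} → Staircase r → ∀ c → r c ≢ suc (suc (r (suc (suc c)))) → Gap r c ⊎ Gap r (suc c)
some-gap st c n with st c | st (suc c)
... | inj₂ g | _       = inj₁ g
... | _      | inj₂ g  = inj₂ g
... | inj₁ b | inj₁ b′ = ⊥-elim (n (trans b (cong suc b′)))

module Crystal (ℓ : ℕ) .{{_ : NonZero ℓ}} (2≤ℓ : 2 ≤ ℓ) (i : ℕ) (i<ℓ : i < ℓ) where
  open Residues ℓ 2≤ℓ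

  ≋-suc⇒≋̸ : ∀ {c} → suc c ≋ suc i → ¬ (c ≋ suc i)
  ≋-suc⇒≋̸ {c} e e′ = suc-≋̸ c (trans e (sym e′))

  suc-≋⇒≋̸ : ∀ {c} → suc c ≋ suc i → ¬ (suc (suc c) ≋ suc i)
  suc-≋⇒≋̸ {c} e e′ = suc-≋̸ (suc c) (trans e′ (sym e))

  -- An addable i-box is a bead free to move from `c` to `c + 1`, a removable one a bead free to
  -- move back. The index `c + 1` of the box is congruent to its residue plus one.
  Plus Minus : (r : ℕ → ℕ) → ℕ → Set
  Plus  r c = suc c ≋ suc i × Bead r c × Gap r (suc c)
  Minus r c = suc c ≋ suc i × Gap r c × Bead r (suc c)

  -- `K` stays variable because a box is sure to have an index only once `K` is at least its row.
  rankₖ : ℕ → Partition → ℕ → ℕ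
  rankₖ K = Abacus.rank (K * ℓ)

  Indexₖ : ℕ → ℕ → Box → Set
  Indexₖ K = Abacus.Index (K * ℓ)

  stairs : ∀ K p → Staircase (rankₖ K p)
  stairs K = Abacus.rank-staircase (K * ℓ)

  index-exists : ∀ K {a} b → a ≤ K → ∃ λ c → Indexₖ K (suc c) (a , b)
  index-exists K {a} b a≤K = b + K * ℓ ∸ a ,
    cong suc (sym (m∸n+n≡m (≤-trans a≤K (≤-trans (m≤m*n K ℓ) (m≤n+m (K * ℓ) b)))))

  index-column : ∀ K {t a b b′} → Indexₖ K t (a , b) → Indexₖ K t (a , b′) → b ≡ b′
  index-column K {b = b} {b′} e e′ = +-cancelʳ-≡ (K * ℓ) b b′ (suc-injective (trans e (sym e′)))

  index-mono : ∀ K {t t′ a b a′ b′} → (a , b) ◁ (a′ , b′) → b ≤ b′ →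
               Indexₖ K t (a , b) → Indexₖ K t′ (a′ , b′) → t < t′
  index-mono K {t} {t′} {a} {b} {a′} {b′} (inj₁ l) b≤ e e′ = +-cancelʳ-< a t t′
    (≤-trans (s≤s (≤-trans (≤-reflexive (sym e)) (≤-trans (s≤s (+-monoˡ-≤ (K * ℓ) b≤)) (≤-reflexive e′)))) (+-monoʳ-< t′ l))
  index-mono K {t} {t′} {a} {b} {_} {b′} (inj₂ (refl , l)) _ e e′ = +-cancelʳ-< a t t′
    (≤-trans (s≤s (≤-reflexive (sym e))) (≤-trans (s≤s (+-monoˡ-< (K * ℓ) l)) (≤-reflexive e′)))

  module _ (K : ℕ) (p : Partition) where
    open Abacus (K * ℓ) using (part⇒bead; part⇒rank; bead⇒part; removable-corner)

    -- A bead at `c + 1` would belong to the previous row and make it as long as the row of `x`.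
    addable⇒plus : ∀ {c x} → Addable p x → residue ℓ x ≡ i → Indexₖ K (suc c) x →
                   Plus (rankₖ K p) c × rankₖ K p (suc c) ≡ row x
    addable⇒plus {c} {a , b} ad r ix with addable⇒corner p (a , b) ad
    ... | e , above = (trans (index⇒≋ ℓ 2≤ℓ K {suc c} {a , b} ix) (cong (λ r → suc r % ℓ) r) , part⇒bead p row≡ , gap)
                    , proj₁ (part⇒rank p row≡)
      where
      row≡ : part p a + K * ℓ ≡ c + a
      row≡ = trans (cong (_+ K * ℓ) e) (suc-injective ix)
      gap : Gap (rankₖ K p) (suc c)
      gap with stairs K p (suc c)
      ... | inj₂ g = g
      ... | inj₁ bead = ⊥-elim (<-irrefl (+-cancelʳ-≡ (K * ℓ) _ _ (sym (trans (bead⇒part p (suc c) bead)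
              (trans (sym (+-suc c _)) (trans (cong (c +_) (sym a≡)) (suc-injective (sym ix))))))) (above _ a≡))
        where
        a≡ : a ≡ suc (rankₖ K p (suc (suc c)))
        a≡ = trans (sym (proj₁ (part⇒rank p row≡))) bead

    plus⇒addable : ∀ {c} → Plus (rankₖ K p) c →
      ∃ λ b → Indexₖ K (suc c) (rankₖ K p (suc c) , b) × Addable p (rankₖ K p (suc c) , b)
            × residue ℓ (rankₖ K p (suc c) , b) ≡ i
    plus⇒addable {c} (e , bead , gap) = part p a , ix , corner⇒addable p _ (refl , above)
                                      , index⇒residue ℓ 2≤ℓ K {suc c} {a , part p a} i<ℓ ix e
      where
      a = rankₖ K p (suc c)
      ix : Indexₖ K (suc c) (a , part p a)
      ix = cong suc (bead⇒part p c bead)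
      above : ∀ a′ → a ≡ suc a′ → part p a < part p a′
      above a′ a≡ = ≤∧≢⇒< (part-antitone p (≤-trans (n≤1+n a′) (≤-reflexive (sym a≡)))) λ e →
        ¬bead∧gap (rankₖ K p) (suc c) (part⇒bead p {suc c} {a′}
          (trans (cong (_+ K * ℓ) (sym e)) (trans (suc-injective ix) (trans (cong (c +_) a≡) (+-suc c a′))))) gap

    -- A bead at `c` would belong to the next row and make it as long as the row of `x`.
    removable⇒minus : ∀ {c x} → Removable p x → residue ℓ x ≡ i → Indexₖ K (suc c) x →
                      Minus (rankₖ K p) c × rankₖ K p (suc (suc c)) ≡ row x
    removable⇒minus {c} {a , b} re r ix with removable⇒corner p (a , b) re
    ... | e , below = (trans (index⇒≋ ℓ 2≤ℓ K {suc c} {a , b} ix) (cong (λ r → suc r % ℓ) r) , gap , part⇒bead p row≡)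
                    , proj₁ (part⇒rank p row≡)
      where
      row≡ : part p a + K * ℓ ≡ suc c + a
      row≡ = trans (cong (_+ K * ℓ) e) ix
      gap : Gap (rankₖ K p) c
      gap with stairs K p c
      ... | inj₂ g = g
      ... | inj₁ bead = ⊥-elim (<⇒≱ (≤-reflexive (sym (+-cancelʳ-≡ (K * ℓ) _ _
              (trans (bead⇒part p c bead) (trans (cong (c +_) (proj₂ (part⇒rank p row≡)))
                (trans (+-suc c a) (sym ix)))))))
              (≤-trans (≤-reflexive (cong (part p) (proj₂ (part⇒rank p row≡)))) below))

    minus⇒removable : ∀ {c} → Minus (rankₖ K p) c →
      ∃ λ b → Indexₖ K (suc c) (rankₖ K p (suc (suc c)) , b) × Removable p (rankₖ K p (suc (suc c)) , b)
            × residue ℓ (rankₖ K p (suc (suc c)) , b) ≡ i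
    minus⇒removable {c} (e , gap , bead) = let b , ix , corner = removable-corner p gap bead in
      b , ix , corner⇒removable p _ corner , index⇒residue ℓ 2≤ℓ K {suc c} {_ , b} i<ℓ ix e

  -- Indices increase along the signature, so this says that no `-` precedes a `+`.
  Separated : Partition → Set
  Separated p = ∀ K {c d} → c < d → Minus (rankₖ K p) c → Plus (rankₖ K p) d → ⊥

  -- The gap `c` would lie below the bead `d`, congruent to it, and the bead `c + 1`, which is not.
  carter⇒separated : ∀ p → (∀ K → Carter (rankₖ K p)) → Separated p
  carter⇒separated p carter K {c} {d} c<d (e , gap , bead) (e′ , bead′ , _) =
    suc-≋̸ c (carter K c<d ≤-refl gap bead′ bead (suc-≋⁻ (trans e′ (sym e))))

  separated⇒reduced : ∀ p → Separated p → reduce (signature ℓ i p) ≡ signature ℓ i p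
  separated⇒reduced p sep = reduce-sorted {p} (go (signature-sorted ℓ i p) (All.tabulate (signature-residue ℓ i p)))
    where
    no-clash : ∀ s t → box {p} s ◁ box t → residue ℓ (box s) ≡ i → residue ℓ (box t) ≡ i → NoClash s t
    no-clash (plus _ _)  _           _ _ _ = tt
    no-clash (minus _ _) (minus _ _) _ _ _ = tt
    no-clash (minus (a , b) re) (plus (a′ , b′) ad) l r r′ =
      -- `a` is the larger of the two rows, so with `K = a` both boxes have an index.
      sep a (s≤s⁻¹ (index-mono a l b≤b′ (proj₂ ix) (proj₂ ix′))) (proj₁ (removable⇒minus a p re r (proj₂ ix)))
                                                     (proj₁ (addable⇒plus a p ad r′ (proj₂ ix′)))
      where
      a′≤a : a′ ≤ a
      a′≤a = [ <⇒≤ , (λ (e , _) → ≤-reflexive (sym e)) ]′ l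
      ix = index-exists a {a} b ≤-refl
      ix′ = index-exists a {a′} b′ a′≤a
      b≤b′ : b ≤ b′
      b≤b′ = ≤-trans (n≤1+n b) (≤-trans (≤-reflexive (sym (proj₁ (removable⇒corner p (a , b) re))))
               (≤-trans (part-antitone p a′≤a) (≤-reflexive (proj₁ (addable⇒corner p (a′ , b′) ad)))))
    go : ∀ {w} → AllPairs (λ s t → box s ◁ box t) w → All (λ s → residue ℓ (box s) ≡ i) w → AllPairs NoClash w
    go [] _ = []
    go (ls ∷ rest) (r ∷ rs) = All.zipWith (λ (l , r′) → no-clash _ _ l r r′) (ls , rs) ∷ go rest rs

  conormals : (p : Partition) → List (∃ (Addable p))
  conormals p = conormal (signature ℓ i p)

  normals : (p : Partition) → List (∃ (Removable p))
  normals p = normal (signature ℓ i p)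

  conormalBoxes≡ : ∀ p → Separated p → conormalBoxes ℓ i p ≡ conormals p
  conormalBoxes≡ p sep = cong conormal (separated⇒reduced p sep)

  normalBoxes≡ : ∀ p → Separated p → normalBoxes ℓ i p ≡ normals p
  normalBoxes≡ p sep = cong normal (separated⇒reduced p sep)

  conormal-residue : ∀ p {z} → z ∈ conormals p → residue ℓ (proj₁ z) ≡ i
  conormal-residue p z∈ = signature-residue ℓ i p (∈-conormal⁻ (signature ℓ i p) z∈)

  normal-residue : ∀ p {z} → z ∈ normals p → residue ℓ (proj₁ z) ≡ i
  normal-residue p z∈ = signature-residue ℓ i p (∈-normal⁻ (signature ℓ i p) z∈)

  -- An i-box changes the count only at its index, which is congruent to `i + 1`. What is preserved
  -- is the number of beads in each pair `c`, `c + 1` with `suc c ≋ suc i`, and every position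
  -- outside the pairs.
  Agree : Partition → Partition → Set
  Agree p q = ∀ K t → ¬ (t ≋ suc i) → rankₖ K p t ≡ rankₖ K q t

  -- One comparison serves both operators: the new partition is `upper` for `f̃` and `lower` for
  -- `ẽ`.
  module Flip (upper lower : Partition) (y : Box) (low≐ : lower ≐ upper ∖ [ y ]) (y∈ : y ∈ᵈ upper)
              (y-residue : residue ℓ y ≡ i) where

    unchanged : ∀ K {t} → ¬ Indexₖ K t y → rankₖ K upper t ≡ rankₖ K lower t
    unchanged K n = Abacus.rank-unchanged (K * ℓ) upper lower low≐ λ { (here refl) → n }

    changed : ∀ K {t} → Indexₖ K t y → rankₖ K upper t ≡ suc (rankₖ K lower t)
    changed K ix = Abacus.rank-removed (K * ℓ) upper lower low≐ (here refl) y∈ ix λ { (here e) _ → e }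

    agree : Agree upper lower
    agree K t n = unchanged K λ ix → n (trans (index⇒≋ ℓ 2≤ℓ K {t} {y} ix) (cong (λ r → suc r % ℓ) y-residue))

    -- At the index of `y` the count of `upper` exceeds that of `lower` by one, while the counts at
    -- `c` agree. A bead of `upper` at `c` would make the count of `lower` drop by two there.
    plus-upper : ∀ K {c} → Plus (rankₖ K upper) c → ¬ Indexₖ K (suc c) y
    plus-upper K {c} (e , b , g) ix = <⇒≱ (≤-reflexive (sym (trans (sym (agree K c (≋-suc⇒≋̸ e)))
      (trans b (cong suc (changed K ix))))) ) below
      where
      below : rankₖ K lower c ≤ suc (rankₖ K lower (suc c))
      below with stairs K lower c
      ... | inj₁ b = ≤-reflexive b
      ... | inj₂ g = ≤-trans (≤-reflexive g) (n≤1+n _)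

    minus-lower : ∀ K {c} → Minus (rankₖ K lower) c → ¬ Indexₖ K (suc c) y
    minus-lower K {c} (e , g , b) ix = <⇒≱ (≤-reflexive (sym (trans (changed K ix) (cong suc (trans (sym g)
      (sym (agree K c (≋-suc⇒≋̸ e)))))))) (staircase-antitone (stairs K upper) (n≤1+n c))

    module _ K {c} (e : suc c ≋ suc i) (n : ¬ Indexₖ K (suc c) y) where

      agree₀ : rankₖ K upper c ≡ rankₖ K lower c
      agree₀ = agree K c (≋-suc⇒≋̸ e)

      agree₁ : rankₖ K upper (suc c) ≡ rankₖ K lower (suc c)
      agree₁ = unchanged K n

      agree₂ : rankₖ K upper (suc (suc c)) ≡ rankₖ K lower (suc (suc c))
      agree₂ = agree K (suc (suc c)) (suc-≋⇒≋̸ e)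

    plus-↓ : ∀ K {c} → ¬ Indexₖ K (suc c) y → Plus (rankₖ K upper) c → Plus (rankₖ K lower) c
    plus-↓ K n (e , b , g) = e , trans (sym (agree₀ K e n)) (trans b (cong suc (agree₁ K e n)))
                               , trans (sym (agree₁ K e n)) (trans g (agree₂ K e n))

    plus-↑ : ∀ K {c} → ¬ Indexₖ K (suc c) y → Plus (rankₖ K lower) c → Plus (rankₖ K upper) c
    plus-↑ K n (e , b , g) = e , trans (agree₀ K e n) (trans b (cong suc (sym (agree₁ K e n))))
                               , trans (agree₁ K e n) (trans g (sym (agree₂ K e n)))

    minus-↓ : ∀ K {c} → ¬ Indexₖ K (suc c) y → Minus (rankₖ K upper) c → Minus (rankₖ K lower) c
    minus-↓ K n (e , g , b) = e , trans (sym (agree₀ K e n)) (trans g (agree₁ K e n))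
                                , trans (sym (agree₁ K e n)) (trans b (cong suc (agree₂ K e n)))

    minus-↑ : ∀ K {c} → ¬ Indexₖ K (suc c) y → Minus (rankₖ K lower) c → Minus (rankₖ K upper) c
    minus-↑ K n (e , g , b) = e , trans (agree₀ K e n) (trans g (sym (agree₁ K e n)))
                                , trans (agree₁ K e n) (trans b (cong suc (sym (agree₂ K e n))))

  plus-at : ∀ K p {c z} → Plus (rankₖ K p) c → rankₖ K p (suc c) ≡ row z → Indexₖ K (suc c) z → Addable p z
  plus-at K p {c} {a , b} pl refl ix with plus⇒addable K p pl
  ... | b′ , ix′ , ad , _ with refl ← index-column K {suc c} {a} {b′} {b} ix′ ix = ad

  minus-at : ∀ K p {c z} → Minus (rankₖ K p) c → rankₖ K p (suc (suc c)) ≡ row z → Indexₖ K (suc c) z → Removable p z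
  minus-at K p {c} {a , b} mi refl ix with minus⇒removable K p mi
  ... | b′ , ix′ , re , _ with refl ← index-column K {suc c} {a} {b′} {b} ix′ ix = re

  index? : ∀ K t z → Dec (Indexₖ K t z)
  index? K t (a , b) = suc (b + K * ℓ) ≟ t + a

  conormal-boxes⁺ : ∀ p {z} → Addable p z → residue ℓ z ≡ i → z ∈ map proj₁ (conormals p)
  conormal-boxes⁺ p ad r = ∈-map⁺ proj₁ (proj₂ (addable∈signature ℓ i p r ad))

  conormal-boxes⁻ : ∀ p {z} → z ∈ map proj₁ (conormals p) → Addable p z × residue ℓ z ≡ i
  conormal-boxes⁻ p z∈ with (_ , s) , s∈ , refl ← ∈-map⁻ proj₁ z∈ = s , conormal-residue p s∈

  normal-boxes⁺ : ∀ p {z} → Removable p z → residue ℓ z ≡ i → z ∈ map proj₁ (normals p)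
  normal-boxes⁺ p re r = ∈-map⁺ proj₁ (proj₂ (removable∈signature ℓ i p r re))

  normal-boxes⁻ : ∀ p {z} → z ∈ map proj₁ (normals p) → Removable p z × residue ℓ z ≡ i
  normal-boxes⁻ p z∈ with (_ , s) , s∈ , refl ← ∈-map⁻ proj₁ z∈ = s , normal-residue p s∈

  box-≟ : ∀ (y z : Box) → Dec (z ≡ y)
  box-≟ y z = ≡-dec _≟_ _≟_ z y

  index-row-injective : ∀ K {t x y} → Indexₖ K t x → Indexₖ K t y → row x ≡ row y → x ≡ y
  index-row-injective K {t} {a , b} {_ , b′} ix iy refl = cong (a ,_) (index-column K {t} {a} {b} {b′} ix iy)

  -- Adding the cogood box

  module AddLast (p : Partition) (sep : Separated p) (y : Box) (s : Addable p y)
                 (is-last : last (conormals p) ≡ just (y , s)) (y∈ : (y , s) ∈ conormals p) where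

    q : Partition
    q = proj₁ (proj₂ s)

    private
      y-res : residue ℓ y ≡ i
      y-res = conormal-residue p y∈
      y∈q : y ∈ᵈ q
      y∈q = from (proj₂ (proj₂ s) y) (inj₂ refl)
      open Flip q p y (∪⇒∖ p q (proj₁ s) (proj₂ (proj₂ s))) y∈q y-res

    agreement : Agree p q
    agreement K t n = sym (agree K t n)

    columns : ∀ {z} → Addable p z → z ◁ y → proj₂ z ≤ proj₂ y
    columns {z} ad z◁y = ≤-trans (≤-reflexive (sym (proj₁ (addable⇒corner p z ad))))
      (≤-trans (part-antitone p ([ <⇒≤ , (λ (e , _) → ≤-reflexive (sym e)) ]′ z◁y))
               (≤-reflexive (proj₁ (addable⇒corner p y s))))

    -- Addable boxes in reading order have weakly increasing columns, hence increasing indices, and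
    -- `y` is the last of them.
    rightmost : ∀ K {c d} → Indexₖ K (suc c) y → Plus (rankₖ K p) d → d ≤ c
    rightmost K {c} {d} iy pl = let b , iz , ad , r = plus⇒addable K p pl in
      [ (λ e → ≤-reflexive (suc-injective (+-cancelʳ-≡ (row y) _ _
                 (trans (sym (subst (Indexₖ K (suc d)) (cong proj₁ e) iz)) iy))))
      , (λ z◁y → <⇒≤ (s≤s⁻¹ (index-mono K {suc d} {suc c} z◁y (columns ad z◁y) iz iy))) ]′
      (last-greatest (conormal-sorted {p} (signature-sorted ℓ i p)) is-last (proj₂ (addable∈signature ℓ i p r ad)))

    -- The only new minus is at the index of `y`, and by `rightmost` no plus lies above it.
    separated : Separated q
    separated K {c} {d} c<d mi pl = case (index? K (suc c) y)
      where
      pl′ : Plus (rankₖ K p) d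
      pl′ = plus-↓ K (plus-upper K pl) pl
      case : Dec (Indexₖ K (suc c) y) → ⊥
      case (no n)   = sep K c<d (minus-↓ K n mi) pl′
      case (yes iy) = <⇒≱ c<d (rightmost K iy pl′)

    -- The status of `z` depends on the counts at `c`, `c + 1` and `c + 2`, and only the count at
    -- the index of `y` changes. An addable box with the index of `z` is in the row of `z`, so `y`
    -- has another index.
    still-addable : ∀ {z} → Addable p z → residue ℓ z ≡ i → z ≢ y → Addable q z
    still-addable {z@(a , b)} ad r z≢y =
      let K = a
          c , iz = index-exists K {a} b ≤-refl
          pl , row≡ = addable⇒plus K p {c} {z} ad r iz
          n : ¬ Indexₖ K (suc c) y
          n = λ iy → z≢y (index-row-injective K {suc c} {z} {y} iz iy
                (trans (sym row≡) (proj₂ (addable⇒plus K p {c} {y} s y-res iy))))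
      in plus-at K q {c} {z} (plus-↑ K n pl) (trans (agree₁ K (proj₁ pl) n) row≡) iz

    was-addable : ∀ {z} → Addable q z → residue ℓ z ≡ i → Addable p z
    was-addable {z@(a , b)} ad r =
      let K = a
          c , iz = index-exists K {a} b ≤-refl
          pl , row≡ = addable⇒plus K q {c} {z} ad r iz
          n = plus-upper K pl
      in plus-at K p {c} {z} (plus-↓ K n pl) (trans (sym (agree₁ K (proj₁ pl) n)) row≡) iz

    count : length (conormals p) ≡ suc (length (conormals q))
    count = trans (sym (length-map proj₁ (conormals p))) (trans
      (unique-length (sorted⇒unique (conormal-sorted {p} (signature-sorted ℓ i p)))
                     (sorted⇒unique (conormal-sorted {q} (signature-sorted ℓ i q)))
        (∈-map⁺ proj₁ y∈) (λ y∈′ → proj₁ (proj₁ (conormal-boxes⁻ q y∈′)) y∈q)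
        (λ z∈ z≢y → let ad , r = conormal-boxes⁻ p z∈ in conormal-boxes⁺ q (still-addable ad r z≢y) r)
        (λ z∈ → let ad , r = conormal-boxes⁻ q z∈ in conormal-boxes⁺ p (was-addable ad r) r) (box-≟ y))
      (cong suc (length-map proj₁ (conormals q))))

  f̃-step : ∀ p {n} → Separated p → φᵢ ℓ i p ≡ suc n →
           ∃ λ q → f̃ ℓ i p ≡ just q × Separated q × φᵢ ℓ i q ≡ n × Agree p q
  f̃-step p {n} sep φ≡ with last-exists (conormals p) (trans (cong length (sym (conormalBoxes≡ p sep))) φ≡)
  ... | (y , s) , e , y∈ = q , cong (Maybe.map (add p)) (trans (cong last (conormalBoxes≡ p sep)) e) , separated
      , suc-injective (trans (cong suc (cong length (conormalBoxes≡ q separated)))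
          (trans (sym count) (trans (cong length (sym (conormalBoxes≡ p sep))) φ≡)))
      , agreement
    where open AddLast p sep y s e y∈

  -- Removing the good box

  module RemoveFirst (p : Partition) (sep : Separated p) (y : Box) (s : Removable p y)
                     {rest : List (∃ (Removable p))} (is-first : normals p ≡ (y , s) ∷ rest) where

    q : Partition
    q = proj₁ (proj₂ s)

    private
      y∈ : (y , s) ∈ normals p
      y∈ = subst ((y , s) ∈_) (sym is-first) (here refl)
      y-res : residue ℓ y ≡ i
      y-res = normal-residue p y∈
      open Flip p q y (proj₂ (proj₂ s)) (proj₁ s) y-res

    agreement : Agree p q
    agreement = agree

    first-least : ∀ {z} → z ∈ normals p → z ≡ (y , s) ⊎ y ◁ proj₁ z
    first-least {z} z∈ = compare (subst (AllPairs _) is-first (normal-sorted {p} (signature-sorted ℓ i p)))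
                                 (subst (z ∈_) is-first z∈)
      where
      compare : ∀ {ns} → AllPairs (λ s t → proj₁ s ◁ proj₁ t) ((y , s) ∷ ns) → z ∈ (y , s) ∷ ns → z ≡ (y , s) ⊎ y ◁ proj₁ z
      compare _        (here e)  = inj₁ e
      compare (rs ∷ _) (there h) = inj₂ (All.lookup rs h)

    columns : ∀ {z} → Removable p z → y ◁ z → proj₂ y ≤ proj₂ z
    columns {z} re y◁z = s≤s⁻¹ (≤-trans (≤-reflexive (sym (proj₁ (removable⇒corner p y s))))
      (≤-trans (part-antitone p ([ <⇒≤ , (λ (e , _) → ≤-reflexive (sym e)) ]′ y◁z))
               (≤-reflexive (proj₁ (removable⇒corner p z re)))))

    leftmost : ∀ K {c d} → Indexₖ K (suc d) y → Minus (rankₖ K p) c → d ≤ c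
    leftmost K {c} {d} iy mi = let b , iz , re , r = minus⇒removable K p mi in
      [ (λ e → ≤-reflexive (suc-injective (+-cancelʳ-≡ (row y) _ _
                 (trans (sym iy) (subst (Indexₖ K (suc c)) (cong proj₁ e) iz)))))
      , (λ y◁z → <⇒≤ (s≤s⁻¹ (index-mono K {suc d} {suc c} y◁z (columns re y◁z) iy iz))) ]′
      (first-least (proj₂ (removable∈signature ℓ i p r re)))

    -- The only new plus is at the index of `y`, and by `leftmost` no minus lies below it.
    separated : Separated q
    separated K {c} {d} c<d mi pl = case (index? K (suc d) y)
      where
      mi′ : Minus (rankₖ K p) c
      mi′ = minus-↑ K (minus-lower K mi) mi
      case : Dec (Indexₖ K (suc d) y) → ⊥
      case (no n)   = sep K c<d mi′ (plus-↑ K n pl)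
      case (yes iy) = <⇒≱ c<d (leftmost K iy mi′)

    still-removable : ∀ {z} → Removable p z → residue ℓ z ≡ i → z ≢ y → Removable q z
    still-removable {z@(a , b)} re r z≢y =
      let K = a
          c , iz = index-exists K {a} b ≤-refl
          mi , row≡ = removable⇒minus K p {c} {z} re r iz
          n : ¬ Indexₖ K (suc c) y
          n = λ iy → z≢y (index-row-injective K {suc c} {z} {y} iz iy
                (trans (sym row≡) (proj₂ (removable⇒minus K p {c} {y} s y-res iy))))
      in minus-at K q {c} {z} (minus-↓ K n mi) (trans (sym (agree₂ K (proj₁ mi) n)) row≡) iz

    was-removable : ∀ {z} → Removable q z → residue ℓ z ≡ i → Removable p z
    was-removable {z@(a , b)} re r =
      let K = a
          c , iz = index-exists K {a} b ≤-refl
          mi , row≡ = removable⇒minus K q {c} {z} re r iz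
          n = minus-lower K mi
      in minus-at K p {c} {z} (minus-↑ K n mi) (trans (agree₂ K (proj₁ mi) n) row≡) iz

    count : length (normals p) ≡ suc (length (normals q))
    count = trans (sym (length-map proj₁ (normals p))) (trans
      (unique-length (sorted⇒unique (normal-sorted {p} (signature-sorted ℓ i p)))
                     (sorted⇒unique (normal-sorted {q} (signature-sorted ℓ i q)))
        (∈-map⁺ proj₁ y∈) (λ y∈′ → ∖[]⇒∉ p q (proj₂ (proj₂ s)) (proj₁ (proj₁ (normal-boxes⁻ q y∈′))))
        (λ z∈ z≢y → let re , r = normal-boxes⁻ p z∈ in normal-boxes⁺ q (still-removable re r z≢y) r)
        (λ z∈ → let re , r = normal-boxes⁻ q z∈ in normal-boxes⁺ p (was-removable re r) r) (box-≟ y))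
      (cong suc (length-map proj₁ (normals q))))

  ẽ-step : ∀ p {n} → Separated p → εᵢ ℓ i p ≡ suc n →
           ∃ λ q → ẽ ℓ i p ≡ just q × Separated q × εᵢ ℓ i q ≡ n × Agree p q
  ẽ-step p {n} sep ε≡ = step (normals p) refl
    where
    length≡ : length (normals p) ≡ suc n
    length≡ = trans (cong length (sym (normalBoxes≡ p sep))) ε≡
    step : ∀ ns → normals p ≡ ns → ∃ λ q → ẽ ℓ i p ≡ just q × Separated q × εᵢ ℓ i q ≡ n × Agree p q
    step [] e = ⊥-elim (0≢1+n (trans (cong length (sym e)) length≡))
    step ((y , s) ∷ rest) e = q , cong (Maybe.map (remove p)) (cong head (trans (normalBoxes≡ p sep) e)) , separated
        , suc-injective (trans (cong suc (cong length (normalBoxes≡ q separated))) (trans (sym count) length≡))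
        , agreement
      where open RemoveFirst p sep y s e

  -- Maximal powers and the return to ℓ-partitions

  -- Each step succeeds and lowers the measure by one, so the power with exponent `measure p` is
  -- defined and ends where the measure vanishes.
  exhaust : (step : Partition → Maybe Partition) (measure : Partition → ℕ) →
    (∀ p {n} → Separated p → measure p ≡ suc n →
       ∃ λ q → step p ≡ just q × Separated q × measure q ≡ n × Agree p q) →
    ∀ n p → Separated p → measure p ≡ n →
    ∃ λ q → power step n p ≡ just q × Separated q × measure q ≡ 0 × Agree p q
  exhaust step measure h zero    p sep e = p , refl , sep , e , λ _ _ _ → refl
  exhaust step measure h (suc n) p sep e with h p sep e
  ... | q , step≡ , sep′ , e′ , agree with exhaust step measure h n q sep′ e′
  ...   | q′ , power≡ , sep″ , e″ , agree′ =
        q′ , trans (cong (_>>= power step n) step≡) power≡ , sep″ , e″ , λ K t n → trans (agree K t n) (agree′ K t n)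

  module Full (p q : Partition) (carter : ∀ K → Carter (rankₖ K p)) (agree : Agree p q) where

    K : ℕ
    -- Large enough for row `K * ℓ` of `q` to be empty, which puts its bead at 0.
    K = length (parts q)

    bounded : part q (K * ℓ) ≡ 0
    bounded = entry-beyond (parts q) (K * ℓ) (m≤m*n K ℓ)

    private
      r r′ : ℕ → ℕ
      r  = rankₖ K p
      r′ = rankₖ K q
      st : Staircase r
      st = stairs K p
      st′ : Staircase r′
      st′ = stairs K q
      bead₀ : Bead r′ 0
      bead₀ = Abacus.part⇒bead (K * ℓ) q {0} {K * ℓ} (cong (_+ K * ℓ) bounded)

      module _ {c} (e : suc c ≋ suc i) where
        e₀ : r c ≡ r′ c
        e₀ = agree K c (≋-suc⇒≋̸ e)
        e₂ : r (suc (suc c)) ≡ r′ (suc (suc c))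
        e₂ = agree K (suc (suc c)) (suc-≋⇒≋̸ e)

        both-beads : Bead r′ c → Bead r′ (suc c) → Bead r c × Bead r (suc c)
        both-beads b b′ = two-beads st c (trans e₀ (trans b (trans (cong suc b′) (cong (λ n → suc (suc n)) (sym e₂)))))

        both-gaps : Gap r′ c → Gap r′ (suc c) → Gap r c × Gap r (suc c)
        both-gaps g g′ = two-gaps st c (trans e₀ (trans g (trans g′ (sym e₂))))

        either-bead : Bead r′ c ⊎ Bead r′ (suc c) → Bead r c ⊎ Bead r (suc c)
        either-bead b = some-bead st c λ h → let g , g′ = two-gaps st′ c (trans (sym e₀) (trans h e₂)) in
          [ (λ b → ¬bead∧gap r′ c b g) , (λ b → ¬bead∧gap r′ (suc c) b g′) ]′ b

        either-gap : Gap r′ c ⊎ Gap r′ (suc c) → Gap r c ⊎ Gap r (suc c)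
        either-gap g = some-gap st c λ h → let b , b′ = two-beads st′ c (trans (sym e₀) (trans h (cong (λ n → suc (suc n)) e₂))) in
          [ (λ g → ¬bead∧gap r′ c b g) , (λ g → ¬bead∧gap r′ (suc c) b′ g) ]′ g

    -- Without a plus, a single bead of a pair stands at the upper position, so in `q` the lower one
    -- is occupied only if both were in `p`. Hence `u c = c` and `v c = suc c`.
    no-plus⇒IsℓPartition : (∀ c → ¬ Plus (rankₖ K q) c) → IsℓPartition ℓ q
    no-plus⇒IsℓPartition none = carter⇒IsℓPartition ℓ 2≤ℓ (K * ℓ) q bounded
      (Transfer.carter′ {r} {r′} (carter K) (suc i) (agree K) bead₀ (λ c → c) suc (inj₁ λ c → refl , refl)
        (λ c e b → both-beads e b (next-bead c e b)) (λ c e b → either-bead e (inj₂ b))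
        (λ c e g → either-gap e (inj₁ g)) (λ c e g → both-gaps e (previous-gap c e g) g))
      where
      next-bead : ∀ c → suc c ≋ suc i → Bead r′ c → Bead r′ (suc c)
      next-bead c e b = [ (λ b′ → b′) , (λ g → ⊥-elim (none c (e , b , g))) ]′ (st′ (suc c))
      previous-gap : ∀ c → suc c ≋ suc i → Gap r′ (suc c) → Gap r′ c
      previous-gap c e g = [ (λ b → ⊥-elim (none c (e , b , g))) , (λ g → g) ]′ (st′ c)

    -- Without a minus, a single bead of a pair stands at the lower position, so `u` and `v`
    -- exchange roles.
    no-minus⇒IsℓPartition : (∀ c → ¬ Minus (rankₖ K q) c) → IsℓPartition ℓ q
    no-minus⇒IsℓPartition none = carter⇒IsℓPartition ℓ 2≤ℓ (K * ℓ) q bounded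
      (Transfer.carter′ {r} {r′} (carter K) (suc i) (agree K) bead₀ suc (λ c → c) (inj₂ λ c → refl , refl)
        (λ c e b → both-beads e (previous-bead c e b) b) (λ c e b → either-bead e (inj₁ b))
        (λ c e g → either-gap e (inj₂ g)) (λ c e g → both-gaps e g (next-gap c e g)))
      where
      previous-bead : ∀ c → suc c ≋ suc i → Bead r′ (suc c) → Bead r′ c
      previous-bead c e b = [ (λ b → b) , (λ g → ⊥-elim (none c (e , g , b))) ]′ (st′ c)
      next-gap : ∀ c → suc c ≋ suc i → Gap r′ c → Gap r′ (suc c)
      next-gap c e g = [ (λ b → ⊥-elim (none c (e , g , b))) , (λ g′ → g′) ]′ (st′ (suc c))

  length≡0⇒∉ : ∀ {A : Set} {xs : List A} {x} → length xs ≡ 0 → x ∉ xs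
  length≡0⇒∉ {xs = []} _ ()

  module _ (p : Partition) (carter : ∀ K → Carter (rankₖ K p)) where
    private
      sep = carter⇒separated p carter

    f̃-power : Any (IsℓPartition ℓ) (power (f̃ ℓ i) (φᵢ ℓ i p) p)
    f̃-power = conclude (exhaust (f̃ ℓ i) (φᵢ ℓ i) f̃-step (φᵢ ℓ i p) p sep refl)
      where
      none : ∀ q → Separated q → φᵢ ℓ i q ≡ 0 → ∀ c → ¬ Plus (rankₖ (length (parts q)) q) c
      none q sep′ φ≡0 c pl = let _ , _ , ad , r = plus⇒addable (length (parts q)) q pl in
        length≡0⇒∉ (trans (cong length (sym (conormalBoxes≡ q sep′))) φ≡0) (proj₂ (addable∈signature ℓ i q r ad))
      conclude : ∀ {m} → (∃ λ q → m ≡ just q × Separated q × φᵢ ℓ i q ≡ 0 × Agree p q) → Any (IsℓPartition ℓ) m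
      conclude (q , refl , sep′ , φ≡0 , agree) = just (Full.no-plus⇒IsℓPartition p q carter agree (none q sep′ φ≡0))

    ẽ-power : Any (IsℓPartition ℓ) (power (ẽ ℓ i) (εᵢ ℓ i p) p)
    ẽ-power = conclude (exhaust (ẽ ℓ i) (εᵢ ℓ i) ẽ-step (εᵢ ℓ i p) p sep refl)
      where
      none : ∀ q → Separated q → εᵢ ℓ i q ≡ 0 → ∀ c → ¬ Minus (rankₖ (length (parts q)) q) c
      none q sep′ ε≡0 c mi = let _ , _ , re , r = minus⇒removable (length (parts q)) q mi in
        length≡0⇒∉ (trans (cong length (sym (normalBoxes≡ q sep′))) ε≡0) (proj₂ (removable∈signature ℓ i q r re))
      conclude : ∀ {m} → (∃ λ q → m ≡ just q × Separated q × εᵢ ℓ i q ≡ 0 × Agree p q) → Any (IsℓPartition ℓ) m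
      conclude (q , refl , sep′ , ε≡0 , agree) = just (Full.no-minus⇒IsℓPartition p q carter agree (none q sep′ ε≡0))

theorem2p4p2p1 : (ℓ : ℕ) .{{_ : NonZero ℓ}} → 2 ≤ ℓ →
    (p : Partition) → IsℓPartition ℓ p → (i : ℕ) → i < ℓ →
    Any (IsℓPartition ℓ) (power (f̃ ℓ i) (φᵢ ℓ i p) p)
    × Any (IsℓPartition ℓ) (power (ẽ ℓ i) (εᵢ ℓ i p) p)
theorem2p4p2p1 ℓ@(suc ℓ-1) 2≤ℓ p isℓ i i<ℓ = f̃-power p carter , ẽ-power p carter
  where
  open Crystal ℓ 2≤ℓ i i<ℓ
  open Residues ℓ 2≤ℓ
  carter : ∀ K → Carter (rankₖ K p)
  carter K = noNonHorizontal⇒carter (K * ℓ) ℓ-1 2≤ℓ p (IsℓPartition.noNonHorizontal isℓ)
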